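{- Let $G$ be a finite simple $4$-connected graph that is not a complete graph. Then $G$ is degree-swappable; that is, for every degree-assignment $L$ of $G$, any two $L$-colorings of $G$ are $L$-equivalent.
   Context: A list-assignment $L$ for a graph $G$ assigns to each vertex $v\in V(G)$ a set (list) of colors $L(v)$. It is a degree-assignment if $|L(v)|\ge d(v)$ for every $v\in V(G)$, where $d(v)$ is the degree of $v$. An $L$-coloring of $G$ is a proper coloring $\varphi$ of $G$ (adjacent vertices receive different colors) with $\varphi(v)\in L(v)$ for every $v$. Given a coloring, a Kempe chain on colors $a$ and $b$ is a connected component of the subgraph induced by the vertices colored $a$ or $b$; a Kempe change is the operation of interchanging the colors $a$ and $b$ on all vertices of one Kempe chain. For an $L$-coloring $\varphi$, a Kempe change is $L$-valid if the resulting coloring is again an $L$-coloring. Two $L$-colorings are $L$-equivalent if one can be obtained from the other by a finite sequence of $L$-valid Kempe changes. A graph $G$ is degree-swappable if for every degree-assignment $L$ of $G$, all $L$-colorings of $G$ are $L$-equivalent. -}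

module Defs where

open import Data.Nat using (ℕ; _≤_; _<_; _≟_)
open import Data.Bool using (Bool; true; false)
open import Data.Fin using (Fin)
open import Data.Fin.Subset using (Subset; _∈_; _∉_; ∣_∣)
open import Data.List using (List; length; filter; deduplicate)
open import Data.List.Membership.Propositional using () renaming (_∈_ to _∈ₗ_)
open import Data.List using () renaming (allFin to allFinₗ)
open import Data.Product using (Σ; ∃; ∃-syntax; _×_; _,_)
open import Data.Sum using (_⊎_)
open import Relation.Nullary using (¬_)
open import Relation.Binary.PropositionalEquality using (_≡_; _≢_)
open import Relation.Binary.Construct.Closure.ReflexiveTransitive using (Star)
open import Data.Bool using () renaming (_≟_ to _≟ᵇ_)

record Graph : Set where
  field
    n       : ℕ
    adj     : Fin n → Fin n → Bool
    sym     : ∀ u v → adj u v ≡ adj v u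
    irrefl  : ∀ v → adj v v ≡ false

module _ (G : Graph) where
  open Graph G

  Vertex : Set
  Vertex = Fin n

  Adj : Vertex → Vertex → Set
  Adj u v = adj u v ≡ true

  degree : Vertex → ℕ
  degree v = length (filter (λ w → adj v w ≟ᵇ true) (allFinₗ n))

  data PathIn (P : Vertex → Set) : Vertex → Vertex → Set where
    here : ∀ {u} → P u → PathIn P u u
    step : ∀ {u w v} → P u → Adj u w → PathIn P w v → PathIn P u v

  ConnectedIn : (Vertex → Set) → Set
  ConnectedIn P = ∀ u v → P u → P v → PathIn P u v

  KConnected : ℕ → Set
  KConnected k = (k < n) × (∀ (S : Subset n) → ∣ S ∣ < k → ConnectedIn (λ v → v ∉ S))

  Complete : Set
  Complete = ∀ u v → u ≢ v → Adj u v

  -- list assignments (colours are natural numbers); |L(v)| is the number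
  -- of distinct colours in the list L v
  ListAssignment : Set
  ListAssignment = Vertex → List ℕ

  IsDegreeAssignment : ListAssignment → Set
  IsDegreeAssignment L = ∀ v → degree v ≤ length (deduplicate _≟_ (L v))

  Coloring : Set
  Coloring = Vertex → ℕ

  IsLColoring : ListAssignment → Coloring → Set
  IsLColoring L φ = (∀ u v → Adj u v → φ u ≢ φ v) × (∀ v → φ v ∈ₗ L v)

  swapCol : ℕ → ℕ → ℕ → ℕ
  swapCol a b c with c ≟ a
  ... | Relation.Nullary.yes _ = b
  ... | Relation.Nullary.no _ with c ≟ b
  ...   | Relation.Nullary.yes _ = a
  ...   | Relation.Nullary.no _ = c

  ColoredAB : Coloring → ℕ → ℕ → Vertex → Set
  ColoredAB φ a b w = (φ w ≡ a) ⊎ (φ w ≡ b)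

  InChain : Coloring → ℕ → ℕ → Vertex → Vertex → Set
  InChain φ a b v w = PathIn (ColoredAB φ a b) v w

  KempeChange : Coloring → Coloring → Set
  KempeChange φ ψ =
    ∃[ a ] ∃[ b ] ∃[ v ] (ColoredAB φ a b v ×
      (∀ w → (InChain φ a b v w → ψ w ≡ swapCol a b (φ w))
           × (¬ InChain φ a b v w → ψ w ≡ φ w)))

  LValidKempe : ListAssignment → Coloring → Coloring → Set
  LValidKempe L φ ψ = IsLColoring L φ × IsLColoring L ψ × KempeChange φ ψ

  LEquivalent : ListAssignment → Coloring → Coloring → Set
  LEquivalent L = Star (LValidKempe L)

  DegreeSwappable : Set
  DegreeSwappable = ∀ (L : ListAssignment) → IsDegreeAssignment L →
    ∀ φ ψ → IsLColoring L φ → IsLColoring L ψ → LEquivalent L φ ψ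

{-# OPTIONS --safe #-}
-- If a precolouring of S leaves a vertex u of the connected graph G − S with a colour to spare (u has more
-- colours than neighbours, or a neighbour in S with a colour foreign to L u, or two neighbours in S of the same
-- colour), then it extends and all its extensions are equivalent; by 4-connectivity this applies to all |S| ≤ 3.
-- If all lists have exactly degree many colours, then by pigeonhole every L-colouring has, at every vertex u, a
-- foreign-coloured neighbour or twins (two neighbours of the same colour).  Hence the classes are those of
-- precolourings of at most two vertices, and classes are joined through common extensions.
-- Lists not all equal: for a colour c, all colourings using c on the boundary of {x | c ∈ L x} are equivalent,
-- and every colouring can be moved there.
-- Lists all equal: the classes are those of the pairs at distance 2, made monochromatic.  Disjoint pairs are
-- joined unless some component K of the rest contains no mid (common neighbour) of either pair; by induction on
-- K it is a clique, all of whose vertices see exactly one vertex of each pair, and pairs inside and around K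
-- then join the two classes.  Pairs sharing a vertex reduce to an induced triangular prism.
module Submission where

open import Defs
open import Data.Bool using (true; false) renaming (_≟_ to _≟ᵇ_)
open import Data.Empty using (⊥; ⊥-elim)
open import Data.Fin using (Fin; _≟_)
open import Data.Fin.Properties using (any?)
open import Data.Fin.Subset using (Subset; _∈_; _∉_; _⊂_; _⊃_; _∪_; _∩_; ∁; ⁅_⁆; ∣_∣) renaming (⊥ to ∅)
open import Data.Fin.Subset.Induction using (Acc; acc; ⊂-wellFounded; ⊃-wellFounded)
open import Data.Fin.Subset.Properties using (_∈?_; x∈⁅x⁆; x∈⁅y⁆⇒x≡y; x∈p∪q⁻; x∈p∪q⁺; p⊆p∪q; x∈p∩q⁺; x∈p∩q⁻; x∈∁p⇒x∉p; x∉p⇒x∈∁p; ∉⊥; ∈⊤; ∣⊥∣≡0; ∪-identityˡ; ∣p∣≤∣x∷p∣)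
open import Data.List using (List; []; _∷_; _++_; length; filter; allFin; map; deduplicate)
open import Data.List.Membership.Propositional using (find; lose) renaming (_∈_ to _∈ₗ_; _∉_ to _∉ₗ_)
open import Data.List.Membership.Propositional.Properties using (∈-filter⁺; ∈-filter⁻; ∈-allFin; ∈-map⁺; ∈-map⁻; ∈-deduplicate⁻; ∈-deduplicate⁺; ∈-++⁺ˡ; ∈-++⁺ʳ; ∈-++⁻)
open import Data.List.Properties using (filter-notAll; length-map; length-tabulate)
import Data.List.Relation.Unary.All as All
open import Data.List.Relation.Unary.All using ([]; _∷_)
open import Data.List.Relation.Unary.AllPairs using ([]; _∷_)
import Data.List.Relation.Unary.Any as Any
open import Data.List.Relation.Unary.Any using (Any; here; there)
open import Data.List.Relation.Unary.Unique.Propositional using (Unique)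
open import Data.List.Relation.Unary.Unique.Propositional.Properties using (allFin⁺; filter⁺)
import Data.Nat as ℕ
open import Data.Nat using (ℕ; suc; _≤_; _<_; s≤s; z≤n; _<?_)
open import Data.Nat.Properties using (≤-refl; ≤-reflexive; ≤-trans; ≤-<-trans; <⇒≱; ≮⇒≥; n≤1+n)
open import Data.List.Relation.Unary.Unique.DecPropositional.Properties ℕ._≟_ using (deduplicate-!)
open import Data.Product using (∃; ∃₂; _×_; _,_; proj₁; proj₂)
open import Data.Sum using (_⊎_; inj₁; inj₂; [_,_]′)
open import Data.Vec using ([]; _∷_)
open import Function using (case_of_)
open import Relation.Binary.Construct.Closure.ReflexiveTransitive using (Star; ε; _◅_; _◅◅_; reverse)
open import Relation.Binary.Definitions using (DecidableEquality)
open import Relation.Binary.PropositionalEquality using (_≡_; _≢_; refl; sym; trans; cong; subst; ≢-sym)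
open import Relation.Nullary using (¬_; Dec; yes; no; contradiction)
open import Relation.Nullary.Decidable using (_×-dec_; _⊎-dec_; ¬?; decidable-stable; map′; True; toWitness; fromWitness)
open import Relation.Unary using (Decidable)

-- Lists as long as the degree leave no freedom for greedy arguments: the neighbours of a vertex may
-- use up its list. One slack vertex breaks the deadlock, because deleting it gives slack to its
-- neighbours, and so on through the whole component; Kempe changes of the smaller graph are then
-- lifted back vertex by vertex. Twins at `u` are non-adjacent, having the same colour, and have `u`
-- as a common neighbour; this is where pairs at distance 2 come from. Two disjoint pairs make four
-- precoloured vertices, one more than 4-connectivity tolerates, so the rest may have a component
-- without slack. Three of the four vertices never separate it from the fourth, hence it touches all
-- four, and pairs chosen around one of its vertices can only have bad components strictly inside
-- it. A second obstacle is that the common neighbour of a pair may belong to the other pair and is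
-- then lost. `Strong` excludes this for both pairs, `weak` for one. Non-completeness enters with
-- unequal lists, where two adjacent boundary vertices may have a clique as the rest of the graph.

module _ {A : Set} (_≟ᴬ_ : DecidableEquality A) where

  length-remove : ∀ {x} {ys : List A} → x ∈ₗ ys → length (filter (λ y → ¬? (y ≟ᴬ x)) ys) < length ys
  length-remove {x} {ys} x∈ys = filter-notAll (λ y → ¬? (y ≟ᴬ x)) ys (mapAny x∈ys)
    where
    mapAny : ∀ {ys} → x ∈ₗ ys → Any (λ y → ¬ y ≢ x) ys
    mapAny (here refl) = here (λ x≢x → x≢x refl)
    mapAny (there p)   = there (mapAny p)

  ∈-remove : ∀ {x y} {ys : List A} → y ∈ₗ ys → y ≢ x → y ∈ₗ filter (λ y → ¬? (y ≟ᴬ x)) ys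
  ∈-remove {x} = ∈-filter⁺ (λ y → ¬? (y ≟ᴬ x))

  Unique⇒length≤ : ∀ {xs ys : List A} → Unique xs → (∀ {x} → x ∈ₗ xs → x ∈ₗ ys) → length xs ≤ length ys
  Unique⇒length≤ []            xs⊆ys = z≤n
  Unique⇒length≤ (x∉xs ∷ uniq) xs⊆ys =
    ≤-trans (s≤s (Unique⇒length≤ uniq λ z∈xs →
               ∈-remove (xs⊆ys (there z∈xs)) (≢-sym (All.lookup x∉xs z∈xs))))
            (length-remove (xs⊆ys (here refl)))

  pigeonhole : ∀ {xs ys : List A} → Unique xs → length ys < length xs → ∃ λ x → x ∈ₗ xs × x ∉ₗ ys
  pigeonhole {xs} {ys} uniq ys<xs = go xs λ xs⊆ys → <⇒≱ ys<xs (Unique⇒length≤ uniq xs⊆ys)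
    where
    open import Data.List.Membership.DecPropositional _≟ᴬ_ using () renaming (_∈?_ to _∈ₗ?_)
    go : ∀ zs → ¬ (∀ {x} → x ∈ₗ zs → x ∈ₗ ys) → ∃ λ x → x ∈ₗ zs × x ∉ₗ ys
    go []       ¬⊆ = ⊥-elim (¬⊆ λ ())
    go (z ∷ zs) ¬⊆ with z ∈ₗ? ys
    ... | no z∉ys  = z , here refl , z∉ys
    ... | yes z∈ys =
      let x , x∈ , x∉ = go zs (λ zs⊆ → ¬⊆ λ { (here refl) → z∈ys ; (there p) → zs⊆ p })
      in x , there x∈ , x∉

-- Paths and components.

module Paths (G : Graph) where
  open Graph G public using (n; adj)

  V : Set
  V = Vertex G

  infix 4 _~_
  _~_ : V → V → Set
  _~_ = Adj G

  _~?_ : ∀ x y → Dec (x ~ y)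
  x ~? y = adj x y ≟ᵇ true

  ~-sym : ∀ {x y} → x ~ y → y ~ x
  ~-sym {x} {y} = trans (Graph.sym G y x)

  ~-irrefl : ∀ {x} → ¬ x ~ x
  ~-irrefl {x} x~x = case trans (sym (Graph.irrefl G x)) x~x of λ ()

  ~⇒≢ : ∀ {x y} → x ~ y → x ≢ y
  ~⇒≢ x~x refl = ~-irrefl x~x

  ≁-sym : ∀ {x y} → ¬ x ~ y → ¬ y ~ x
  ≁-sym x≁y y~x = x≁y (~-sym y~x)

  private
    variable
      P Q : V → Set
      u v w : V

  path-start : PathIn G P u v → P u
  path-start (here pu)     = pu
  path-start (step pu _ _) = pu

  path-map : (∀ {x} → P x → Q x) → PathIn G P u v → PathIn G Q u v
  path-map f (here pu)      = here (f pu)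
  path-map f (step pu e p)  = step (f pu) e (path-map f p)

  path-++ : PathIn G P u v → PathIn G P v w → PathIn G P u w
  path-++ (here _)      q = q
  path-++ (step pu e p) q = step pu e (path-++ p q)

  path-∷ʳ : PathIn G P u v → v ~ w → P w → PathIn G P u w
  path-∷ʳ (here pu)     e pw = step pu e (here pw)
  path-∷ʳ (step pu f p) e pw = step pu f (path-∷ʳ p e pw)

  path-reverse : PathIn G P u v → PathIn G P v u
  path-reverse (here pu)     = here pu
  path-reverse (step pu e p) = path-∷ʳ (path-reverse p) (~-sym e) pu

  path-invariant : (∀ {x y} → Q x → x ~ y → P y → Q y) → Q u → PathIn G P u v → Q v
  path-invariant inv qu (here _)     = qu
  path-invariant inv qu (step _ e p) = path-invariant inv (inv qu e (path-start p)) p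

  path-exit : Decidable Q → PathIn G P u v → Q u → ¬ Q v →
              ∃₂ λ x y → PathIn G (λ t → P t × Q t) u x × x ~ y × P y × ¬ Q y
  path-exit Q? (here _) qu ¬qv = contradiction qu ¬qv
  path-exit Q? (step {w = w} pu e p) qu ¬qv with Q? w
  ... | no ¬qw = _ , w , here (pu , qu) , e , path-start p , ¬qw
  ... | yes qw = let x , y , p′ , r = path-exit Q? p qw ¬qv in x , y , step (pu , qu) e p′ , r

  path-end : PathIn G P u v → P v
  path-end (here pu)    = pu
  path-end (step _ _ p) = path-end p

  -- Held as a `Subset`, so that membership is decidable and inclusion is well-founded.
  record Component (P : V → Set) (v : V) : Set where
    field
      carrier : Subset n
      root    : v ∈ carrier
      reached : ∀ {w} → w ∈ carrier → PathIn G P v w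
      closed  : ∀ {x y} → x ∈ carrier → x ~ y → P y → y ∈ carrier

  component : Decidable P → P v → Component P v
  component {P} {v} P? pv = grow ⁅ v ⁆ (⊃-wellFounded ⁅ v ⁆) (x∈⁅x⁆ v)
                              (λ w∈ → subst (PathIn G P v) (sym (x∈⁅y⁆⇒x≡y v w∈)) (here pv))
    where
    grow : ∀ R → Acc _ R → v ∈ R → (∀ {w} → w ∈ R → PathIn G P v w) → Component P v
    grow R (acc rec) v∈R reached
      with any? (λ x → any? (λ y → (x ∈? R) ×-dec (x ~? y) ×-dec P? y ×-dec ¬? (y ∈? R)))
    ... | yes (x , y , x∈R , x~y , py , y∉R) =
      grow (R ∪ ⁅ y ⁆) (rec ((λ {_} → p⊆p∪q _) , y , x∈p∪q⁺ (inj₂ (x∈⁅x⁆ y)) , y∉R)) (p⊆p∪q _ v∈R)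
        λ w∈ → case x∈p∪q⁻ R ⁅ y ⁆ w∈ of λ
          { (inj₁ w∈R) → reached w∈R
          ; (inj₂ w∈y) → subst (PathIn G P v) (sym (x∈⁅y⁆⇒x≡y y w∈y)) (path-∷ʳ (reached x∈R) x~y py) }
    ... | no ¬ext = record
      { carrier = R ; root = v∈R ; reached = reached
      ; closed  = λ {x} {y} x∈R x~y py → decidable-stable (y ∈? R) λ y∉R → ¬ext (x , y , x∈R , x~y , py , y∉R) }

  path? : Decidable P → ∀ u v → Dec (PathIn G P u v)
  path? P? u v with P? u
  ... | no ¬pu = no λ p → ¬pu (path-start p)
  ... | yes pu = map′ reached (path-invariant closed root) (v ∈? carrier)
    where open Component (component P? pu)

-- Kempe changes on unions of chains.

module Swaps (G : Graph) where
  open Paths G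

  update : Coloring G → V → ℕ → Coloring G
  update f x e w with w ≟ x
  ... | yes _ = e
  ... | no _  = f w

  update-eq : ∀ f x e → update f x e x ≡ e
  update-eq f x e with x ≟ x
  ... | yes _  = refl
  ... | no x≢x = contradiction refl x≢x

  update-neq : ∀ f {x} e {w} → w ≢ x → update f x e w ≡ f w
  update-neq f {x} e {w} w≢x with w ≟ x
  ... | yes w≡x = contradiction w≡x w≢x
  ... | no _    = refl

  Coloured? : ∀ (φ : Coloring G) a b w → Dec (ColoredAB G φ a b w)
  Coloured? φ a b w = (φ w ℕ.≟ a) ⊎-dec (φ w ℕ.≟ b)

  swap-fst : ∀ {a b c} → c ≡ a → swapCol G a b c ≡ b
  swap-fst {a} {b} {c} c≡a with c ℕ.≟ a
  ... | yes _  = refl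
  ... | no c≢a = contradiction c≡a c≢a

  swap-snd : ∀ {a b c} → c ≡ b → swapCol G a b c ≡ a
  swap-snd {a} {b} {c} c≡b with c ℕ.≟ a
  ... | yes c≡a = trans (sym c≡b) c≡a
  ... | no _ with c ℕ.≟ b
  ...   | yes _  = refl
  ...   | no c≢b = contradiction c≡b c≢b

  swap-other : ∀ {a b c} → ¬ (c ≡ a ⊎ c ≡ b) → swapCol G a b c ≡ c
  swap-other {a} {b} {c} ¬ab with c ℕ.≟ a
  ... | yes c≡a = contradiction (inj₁ c≡a) ¬ab
  ... | no _ with c ℕ.≟ b
  ...   | yes c≡b = contradiction (inj₂ c≡b) ¬ab
  ...   | no _    = refl

  swap-coloured : ∀ {a b c} → c ≡ a ⊎ c ≡ b → swapCol G a b c ≡ a ⊎ swapCol G a b c ≡ b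
  swap-coloured (inj₁ c≡a) = inj₂ (swap-fst c≡a)
  swap-coloured (inj₂ c≡b) = inj₁ (swap-snd c≡b)

  swap-involutive : ∀ a b c → swapCol G a b (swapCol G a b c) ≡ c
  swap-involutive a b c = case c ℕ.≟ a of λ
    { (yes c≡a) → trans (swap-snd (swap-fst c≡a)) (sym c≡a)
    ; (no c≢a)  → case c ℕ.≟ b of λ
        { (yes c≡b) → trans (swap-fst (swap-snd c≡b)) (sym c≡b)
        ; (no c≢b)  → trans (cong (swapCol G a b) (swap-other [ c≢a , c≢b ]′)) (swap-other [ c≢a , c≢b ]′) } }

  swap-injective : ∀ a b {c d} → swapCol G a b c ≡ swapCol G a b d → c ≡ d
  swap-injective a b {c} {d} eq =
    trans (sym (swap-involutive a b c)) (trans (cong (swapCol G a b) eq) (swap-involutive a b d))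

  -- `K` is a union of chains together with vertices of other colours, on which the swap is idle;
  -- all of `V` is allowed and gives a global exchange of two colours.
  record SwapOn (a b : ℕ) (K : Subset n) (φ ψ : Coloring G) : Set where
    field
      inside  : ∀ {w} → w ∈ K → ψ w ≡ swapCol G a b (φ w)
      outside : ∀ {w} → w ∉ K → ψ w ≡ φ w
      closed  : ∀ {y z} → y ∈ K → y ~ z → ColoredAB G φ a b y → ColoredAB G φ a b z → z ∈ K

  module _ (L : ListAssignment G) where

    -- Pointwise equal colourings need not be the same function, so `ε` does not join them;
    -- exchanging the colour `φ v` with itself is a Kempe change that does.
    ≗⇒LEquivalent : ∀ {φ ψ} → V → IsLColoring G L φ → IsLColoring G L ψ → (∀ w → ψ w ≡ φ w) → LEquivalent G L φ ψ
    ≗⇒LEquivalent {φ} {ψ} v Lφ Lψ ψ≗φ =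
      (Lφ , Lψ , φ v , φ v , v , inj₁ refl , λ w → (λ _ → trans (ψ≗φ w) (sym (idle w))) , (λ _ → ψ≗φ w)) ◅ ε
      where
      idle : ∀ w → swapCol G (φ v) (φ v) (φ w) ≡ φ w
      idle w = case φ w ℕ.≟ φ v of λ
        { (yes eq) → trans (swap-fst eq) (sym eq)
        ; (no neq) → swap-other [ neq , neq ]′ }

    -- A closed set is a union of Kempe chains, which are swapped one at a time.
    SwapOn⇒LEquivalent : ∀ {a b K φ ψ} → V → IsLColoring G L φ → IsLColoring G L ψ →
                         SwapOn a b K φ ψ → LEquivalent G L φ ψ
    SwapOn⇒LEquivalent {a} {b} {K} v₀ = go K (⊂-wellFounded K)
      where
      go : ∀ K → Acc _⊂_ K → ∀ {φ ψ} → IsLColoring G L φ → IsLColoring G L ψ → SwapOn a b K φ ψ → LEquivalent G L φ ψ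
      go K (acc rec) {φ} {ψ} Lφ Lψ sw with any? (λ v → (v ∈? K) ×-dec Coloured? φ a b v)
      ... | no none = ≗⇒LEquivalent v₀ Lφ Lψ λ w → case w ∈? K of λ
        { (yes w∈K) → trans (SwapOn.inside sw w∈K) (swap-other λ ab → none (w , w∈K , ab))
        ; (no w∉K)  → SwapOn.outside sw w∉K }
      ... | yes (v , v∈K , abv) =
        (Lφ , Lφ₁ , a , b , v , abv , λ w → φ₁-chain , φ₁-off) ◅
        go (K ∩ ∁ C) (rec ((λ {_} → diff⇒∈) , v , v∈K , λ v∈ → diff⇒∉ v∈ comp.root)) Lφ₁ Lψ sw₁
        where
        module comp = Component (component (Coloured? φ a b) abv)
        C : Subset n
        C = comp.carrier

        coloured : ∀ {w} → w ∈ C → ColoredAB G φ a b w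
        coloured w∈C = path-end (comp.reached w∈C)

        C⊆K : ∀ {w} → w ∈ C → w ∈ K
        C⊆K w∈C = proj₁ (path-invariant {Q = λ w → w ∈ K × ColoredAB G φ a b w}
          (λ { (x∈K , abx) x~y aby → SwapOn.closed sw x∈K x~y abx aby , aby }) (v∈K , abv) (comp.reached w∈C))

        φ₁ : Coloring G
        φ₁ w with w ∈? C
        ... | yes _ = swapCol G a b (φ w)
        ... | no _  = φ w

        φ₁-in : ∀ {w} → w ∈ C → φ₁ w ≡ swapCol G a b (φ w)
        φ₁-in {w} w∈C with w ∈? C
        ... | yes _  = refl
        ... | no w∉C = contradiction w∈C w∉C

        φ₁-out : ∀ {w} → w ∉ C → φ₁ w ≡ φ w
        φ₁-out {w} w∉C with w ∈? C
        ... | yes w∈C = contradiction w∈C w∉C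
        ... | no _    = refl

        φ₁-chain : ∀ {w} → InChain G φ a b v w → φ₁ w ≡ swapCol G a b (φ w)
        φ₁-chain p = φ₁-in (path-invariant (λ x∈C x~y aby → comp.closed x∈C x~y aby) comp.root p)

        φ₁-off : ∀ {w} → ¬ InChain G φ a b v w → φ₁ w ≡ φ w
        φ₁-off ¬p = φ₁-out λ w∈C → ¬p (comp.reached w∈C)

        crossing : ∀ {y z} → y ~ z → y ∈ C → z ∉ C → φ₁ y ≢ φ₁ z
        crossing {y} {z} y~z y∈C z∉C eq = z∉C (comp.closed y∈C y~z
          (subst (λ c → c ≡ a ⊎ c ≡ b) (trans (sym (φ₁-in y∈C)) (trans eq (φ₁-out z∉C))) (swap-coloured (coloured y∈C))))

        proper₁ : ∀ y z → y ~ z → φ₁ y ≢ φ₁ z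
        proper₁ y z y~z eq with y ∈? C | z ∈? C
        ... | yes y∈C | yes z∈C = proj₁ Lφ y z y~z (swap-injective a b eq)
        ... | no y∉C  | no z∉C  = proj₁ Lφ y z y~z eq
        ... | yes y∈C | no z∉C  = crossing y~z y∈C z∉C (trans (φ₁-in y∈C) (trans eq (sym (φ₁-out z∉C))))
        ... | no y∉C  | yes z∈C = crossing (~-sym y~z) z∈C y∉C (trans (φ₁-in z∈C) (trans (sym eq) (sym (φ₁-out y∉C))))

        -- On the chain `φ₁` has already the final colour `ψ w`, elsewhere still `φ w`; hence
        -- swapping one chain at a time never leaves the lists.
        list₁ : ∀ w → φ₁ w ∈ₗ L w
        list₁ w with w ∈? C
        ... | yes w∈C = subst (_∈ₗ L w) (SwapOn.inside sw (C⊆K w∈C)) (proj₂ Lψ w)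
        ... | no _    = proj₂ Lφ w

        Lφ₁ : IsLColoring G L φ₁
        Lφ₁ = proper₁ , list₁

        coloured₁⇒coloured : ∀ {w} → w ∉ C → ColoredAB G φ₁ a b w → ColoredAB G φ a b w
        coloured₁⇒coloured w∉C = subst (λ c → c ≡ a ⊎ c ≡ b) (φ₁-out w∉C)

        diff⇒∈ : ∀ {w} → w ∈ K ∩ ∁ C → w ∈ K
        diff⇒∈ w∈ = proj₁ (x∈p∩q⁻ K (∁ C) w∈)

        diff⇒∉ : ∀ {w} → w ∈ K ∩ ∁ C → w ∉ C
        diff⇒∉ w∈ = x∈∁p⇒x∉p (proj₂ (x∈p∩q⁻ K (∁ C) w∈))

        ∈-diff : ∀ {w} → w ∈ K → w ∉ C → w ∈ K ∩ ∁ C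
        ∈-diff w∈K w∉C = x∈p∩q⁺ (w∈K , x∉p⇒x∈∁p w∉C)

        sw₁ : SwapOn a b (K ∩ ∁ C) φ₁ ψ
        sw₁ = record
          { inside  = λ w∈ → trans (SwapOn.inside sw (diff⇒∈ w∈)) (cong (swapCol G a b) (sym (φ₁-out (diff⇒∉ w∈))))
          ; outside = λ {w} w∉ → case w ∈? C of λ
              { (yes w∈C) → trans (SwapOn.inside sw (C⊆K w∈C)) (sym (φ₁-in w∈C))
              ; (no w∉C)  → trans (SwapOn.outside sw (λ w∈K → w∉ (∈-diff w∈K w∉C))) (sym (φ₁-out w∉C)) }
          ; closed  = λ {y} {z} y∈ y~z aby abz → case z ∈? C of λ
              { (yes z∈C) → contradiction (comp.closed z∈C (~-sym y~z) (coloured₁⇒coloured (diff⇒∉ y∈) aby)) (diff⇒∉ y∈)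
              ; (no z∉C)  → ∈-diff
                  (SwapOn.closed sw (diff⇒∈ y∈) y~z (coloured₁⇒coloured (diff⇒∉ y∈) aby) (coloured₁⇒coloured z∉C abz)) z∉C }
          }

    -- The exchange permutes the two colours, so `v` has the same chain before and after it, and
    -- exchanging there again undoes it.
    LValidKempe-sym : ∀ {φ ψ} → LValidKempe G L φ ψ → LValidKempe G L ψ φ
    LValidKempe-sym {φ} {ψ} (Lφ , Lψ , a , b , v , abv , change) =
      Lψ , Lφ , a , b , v , recoloured (here abv) ,
      λ w → (λ p → trans (sym (swap-involutive a b (φ w))) (cong (swapCol G a b) (sym (proj₁ (change w) (chain⁻ p)))))
          , (λ ¬p → sym (proj₂ (change w) λ p → ¬p (chain⁺ p)))
      where
      recoloured : ∀ {w} → InChain G φ a b v w → ColoredAB G ψ a b w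
      recoloured {w} p = subst (λ c → c ≡ a ⊎ c ≡ b) (sym (proj₁ (change w) p)) (swap-coloured (path-end p))
      coloured⁻ : ∀ {w} → ColoredAB G ψ a b w → ColoredAB G φ a b w
      coloured⁻ {w} ab = decidable-stable (Coloured? φ a b w) λ ¬ab →
        ¬ab (subst (λ c → c ≡ a ⊎ c ≡ b) (proj₂ (change w) λ p → ¬ab (path-end p)) ab)
      chain⁻ : ∀ {w} → InChain G ψ a b v w → InChain G φ a b v w
      chain⁻ = path-invariant (λ p x~y ab → path-∷ʳ p x~y (coloured⁻ ab)) (here abv)
      chain⁺ : ∀ {w} → InChain G φ a b v w → InChain G ψ a b v w
      chain⁺ p = proj₂ (path-invariant {Q = λ y → InChain G φ a b v y × InChain G ψ a b v y}
        (λ { (p , q) x~y ab → let p′ = path-∷ʳ p x~y ab in p′ , path-∷ʳ q x~y (recoloured p′) })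
        (here abv , here (recoloured (here abv))) p)

    LEquivalent-sym : ∀ {φ ψ} → LEquivalent G L φ ψ → LEquivalent G L ψ φ
    LEquivalent-sym = reverse LValidKempe-sym

    -- No neighbour of `w` has its old or its new colour, so `w` alone is a chain.
    recolour : ∀ {φ w c} → IsLColoring G L φ → c ∈ₗ L w → (∀ {z} → w ~ z → φ z ≢ c) →
               IsLColoring G L (update φ w c) × LEquivalent G L φ (update φ w c)
    recolour {φ} {w} {c} Lφ c∈ avoid = Lφ′ , SwapOn⇒LEquivalent w Lφ Lφ′ record
      { inside  = λ t∈ → case x∈⁅y⁆⇒x≡y w t∈ of λ { refl → trans (update-eq φ w c) (sym (swap-fst {φ w} {c} {φ w} refl)) }
      ; outside = λ t∉ → update-neq φ c λ { refl → t∉ (x∈⁅x⁆ w) }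
      ; closed  = λ y∈ y~z _ abz → case x∈⁅y⁆⇒x≡y w y∈ of λ { refl → ⊥-elim (clash y~z abz) } }
      where
      clash : ∀ {z} → w ~ z → ¬ ColoredAB G φ (φ w) c z
      clash w~z (inj₁ eq) = proj₁ Lφ _ _ w~z (sym eq)
      clash w~z (inj₂ eq) = avoid w~z eq
      proper′ : ∀ y z → y ~ z → update φ w c y ≢ update φ w c z
      proper′ y z y~z with y ≟ w | z ≟ w
      ... | yes refl | yes refl = contradiction y~z ~-irrefl
      ... | yes refl | no _     = ≢-sym (avoid y~z)
      ... | no _     | yes refl = avoid (~-sym y~z)
      ... | no _     | no _     = proj₁ Lφ y z y~z
      list′ : ∀ y → update φ w c y ∈ₗ L y
      list′ y with y ≟ w
      ... | yes refl = c∈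
      ... | no _     = proj₂ Lφ y
      Lφ′ : IsLColoring G L (update φ w c)
      Lφ′ = proper′ , list′

-- Neighbours and colours as lists.

module Lists (G : Graph) (L : ListAssignment G) where
  open Paths G
  open import Data.List.Membership.DecPropositional (ℕ._≟_) public using () renaming (_∈?_ to _∈ᶜ?_)
  open import Data.List.Membership.DecPropositional (_≟_ {n}) public using () renaming (_∈?_ to _∈ᵛ?_)

  nbrs : V → List V
  nbrs v = filter (λ w → adj v w ≟ᵇ true) (allFin n)

  ∈-nbrs : ∀ {v w} → v ~ w → w ∈ₗ nbrs v
  ∈-nbrs {v} {w} v~w = ∈-filter⁺ (λ w → adj v w ≟ᵇ true) (∈-allFin w) v~w

  ∈-nbrs⁻ : ∀ {v w} → w ∈ₗ nbrs v → v ~ w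
  ∈-nbrs⁻ {v} w∈ = proj₂ (∈-filter⁻ (λ w → adj v w ≟ᵇ true) {xs = allFin n} w∈)

  size : V → ℕ
  size v = length (deduplicate ℕ._≟_ (L v))

  spare-colour : ∀ {v} {cs : List ℕ} → length cs < size v → ∃ λ e → e ∈ₗ L v × e ∉ₗ cs
  spare-colour {v} cs< =
    let e , e∈ , e∉ = pigeonhole ℕ._≟_ (deduplicate-! (L v)) cs< in e , ∈-deduplicate⁻ ℕ._≟_ (L v) e∈ , e∉

-- Colourings extending a precolouring σ of S.  The vertices of D are deleted; D grows from ∅, always by a
-- vertex x with a colour to spare, so that Kempe changes of G − D − x lift to G − D (Las Vergnas–Meyniel).
module Extension (G : Graph) (L : ListAssignment G) (deg : IsDegreeAssignment G L)
                 (S : List (Vertex G)) (σ : Coloring G) where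
  open Paths G
  open Swaps G
  open Lists G L

  -- `deleted` cannot occur at the start, where `D` is empty; it is how slack spreads as vertices
  -- are removed.
  data Slack (D : Subset n) (u : V) : Set where
    surplus : degree G u < size u → Slack D u
    deleted : ∀ {t} → u ~ t → t ∈ D → Slack D u
    foreign : ∀ {s} → u ~ s → s ∈ₗ S → σ s ∉ₗ L u → Slack D u
    repeat  : ∀ {s t} → u ~ s → u ~ t → s ≢ t → s ∈ₗ S → t ∈ₗ S → σ s ≡ σ t → Slack D u

  -- `seen` bounds the forbidden colours in every extension at once: a neighbour missing from it is
  -- deleted, or precoloured with a colour that `L x` lacks or that `seen` already shows.
  record Room (D : Subset n) (x : V) : Set where
    field
      seen  : List V
      short : length seen < size x
      cover : ∀ {z} → z ∉ D → x ~ z →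
              z ∈ₗ seen ⊎ (z ∈ₗ S × (σ z ∉ₗ L x ⊎ ∃ λ s → s ∈ₗ S × s ∈ₗ seen × σ s ≡ σ z))

  private
    drop-nbr : ∀ {D x t} → x ~ t → (t ∉ D → t ∈ₗ S × (σ t ∉ₗ L x ⊎ ∃ λ s → s ∈ₗ S × (x ~ s × s ≢ t) × σ s ≡ σ t)) → Room D x
    drop-nbr {D} {x} {t} x~t harmless = record
      { seen  = filter (λ y → ¬? (y ≟ t)) (nbrs x)
      ; short = ≤-trans (length-remove _≟_ (∈-nbrs x~t)) (deg x)
      ; cover = cover }
      where
      cover : ∀ {z} → z ∉ D → x ~ z → _
      cover {z} z∉D x~z with z ≟ t
      ... | no z≢t = inj₁ (∈-remove _≟_ (∈-nbrs x~z) z≢t)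
      ... | yes refl with harmless z∉D
      ...   | z∈S , inj₁ σz∉L = inj₂ (z∈S , inj₁ σz∉L)
      ...   | z∈S , inj₂ (s , s∈S , (x~s , s≢z) , eq) = inj₂ (z∈S , inj₂ (s , s∈S , ∈-remove _≟_ (∈-nbrs x~s) s≢z , eq))

  Slack⇒Room : ∀ {D x} → Slack D x → Room D x
  Slack⇒Room (surplus d<) = record { seen = nbrs _ ; short = d< ; cover = λ _ x~z → inj₁ (∈-nbrs x~z) }
  Slack⇒Room (deleted x~t t∈D) = drop-nbr x~t λ t∉D → contradiction t∈D t∉D
  Slack⇒Room (foreign x~s s∈S σs∉) = drop-nbr x~s λ _ → s∈S , inj₁ σs∉
  Slack⇒Room (repeat x~s x~t s≢t s∈S t∈S eq) = drop-nbr x~t λ _ → t∈S , inj₂ (_ , s∈S , (x~s , s≢t) , eq)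

  record Colours (D : Subset n) (f : Coloring G) : Set where
    field
      proper : ∀ {y z} → y ∉ D → z ∉ D → y ~ z → f y ≢ f z
      list   : ∀ {y} → y ∉ D → f y ∈ₗ L y
      fixed  : ∀ {y} → y ∈ₗ S → f y ≡ σ y
  open Colours

  -- The analogue of `SwapOn` in G - D; `free` keeps the precolouring untouched.
  record Step (D : Subset n) (f g : Coloring G) : Set where
    field
      {a b}   : ℕ
      K       : Subset n
      alive   : ∀ {w} → w ∈ K → w ∉ D
      free    : ∀ {w} → w ∈ K → w ∉ₗ S
      inside  : ∀ {w} → w ∈ K → g w ≡ swapCol G a b (f w)
      outside : ∀ {w} → w ∉ D → w ∉ K → g w ≡ f w
      closed  : ∀ {y z} → y ∈ K → z ∉ D → y ~ z → ColoredAB G f a b y → ColoredAB G f a b z → z ∈ K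

  Link : Subset n → Coloring G → Coloring G → Set
  Link D f g = Colours D f × Colours D g × Step D f g

  ≗-link : ∀ {D f g} → Colours D f → Colours D g → (∀ {w} → w ∉ D → g w ≡ f w) → Link D f g
  ≗-link Cf Cg g≗f = Cf , Cg , record
    { a = 0 ; b = 0 ; K = ∅ ; alive = λ p → ⊥-elim (∉⊥ p) ; free = λ p → ⊥-elim (∉⊥ p)
    ; inside = λ p → ⊥-elim (∉⊥ p) ; outside = λ w∉D _ → g≗f w∉D ; closed = λ p → ⊥-elim (∉⊥ p) }

  private
    ∉∪ : ∀ {D : Subset n} {x w} → w ∉ D → w ≢ x → w ∉ D ∪ ⁅ x ⁆
    ∉∪ {D} {x} w∉D w≢x w∈ = [ w∉D , (λ w∈x → w≢x (x∈⁅y⁆⇒x≡y x w∈x)) ]′ (x∈p∪q⁻ D ⁅ x ⁆ w∈)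

    ∉∪ˡ : ∀ {D : Subset n} {x w} → w ∉ D ∪ ⁅ x ⁆ → w ∉ D
    ∉∪ˡ w∉ w∈D = w∉ (p⊆p∪q _ w∈D)

    ∉∪ʳ : ∀ {D : Subset n} {x w} → w ∉ D ∪ ⁅ x ⁆ → w ≢ x
    ∉∪ʳ {x = x} w∉ refl = w∉ (x∈p∪q⁺ (inj₂ (x∈⁅x⁆ x)))

  update-colours : ∀ {D x e h} → Colours (D ∪ ⁅ x ⁆) h → x ∉ₗ S → e ∈ₗ L x →
                   (∀ {z} → z ∉ D → x ~ z → h z ≢ e) → Colours D (update h x e)
  update-colours {D} {x} {e} {h} Ch x∉S e∈L avoid = record { proper = prop ; list = lst ; fixed = fix }
    where
    prop : ∀ {y z} → y ∉ D → z ∉ D → y ~ z → update h x e y ≢ update h x e z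
    prop {y} {z} y∉D z∉D y~z with y ≟ x | z ≟ x
    ... | yes refl | yes refl = contradiction y~z ~-irrefl
    ... | yes refl | no _     = ≢-sym (avoid z∉D y~z)
    ... | no _     | yes refl = avoid y∉D (~-sym y~z)
    ... | no y≢x   | no z≢x   = proper Ch (∉∪ y∉D y≢x) (∉∪ z∉D z≢x) y~z
    lst : ∀ {y} → y ∉ D → update h x e y ∈ₗ L y
    lst {y} y∉D with y ≟ x
    ... | yes refl = e∈L
    ... | no y≢x   = list Ch (∉∪ y∉D y≢x)
    fix : ∀ {y} → y ∈ₗ S → update h x e y ≡ σ y
    fix {y} y∈S with y ≟ x
    ... | yes refl = contradiction y∈S x∉S
    ... | no _     = fixed Ch y∈S

  weaken : ∀ {D x f} → Colours D f → Colours (D ∪ ⁅ x ⁆) f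
  weaken Cf = record
    { proper = λ y∉ z∉ → proper Cf (∉∪ˡ y∉) (∉∪ˡ z∉) ; list = λ y∉ → list Cf (∉∪ˡ y∉) ; fixed = fixed Cf }

  recolour-link : ∀ {D x f g} → x ∉ D → x ∉ₗ S → Colours D f → Colours D g →
                  (∀ {w} → w ∉ D → w ≢ x → g w ≡ f w) → Link D f g
  recolour-link {D} {x} {f} {g} x∉D x∉S Cf Cg off = Cf , Cg , record
    { a = f x ; b = g x ; K = ⁅ x ⁆
    ; alive   = λ w∈ → at w∈ x∉D
    ; free    = λ w∈ → at w∈ x∉S
    ; inside  = λ w∈ → at {λ w → g w ≡ swapCol G (f x) (g x) (f w)} w∈ (sym (swap-fst {f x} {g x} {f x} refl))
    ; outside = λ w∉D w∉ → off w∉D (λ { refl → w∉ (x∈⁅x⁆ x) })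
    ; closed  = λ {y} {z} y∈ z∉D y~z _ abz → ⊥-elim (clash z∉D (subst (_~ z) (x∈⁅y⁆⇒x≡y x y∈) y~z) abz) }
    where
    at : ∀ {P : V → Set} {w} → w ∈ ⁅ x ⁆ → P x → P w
    at {P} w∈ = subst P (sym (x∈⁅y⁆⇒x≡y x w∈))
    clash : ∀ {z} → z ∉ D → x ~ z → ¬ ColoredAB G f (f x) (g x) z
    clash z∉D x~z (inj₁ eq) = proper Cf x∉D z∉D x~z (sym eq)
    clash z∉D x~z (inj₂ eq) = proper Cg x∉D z∉D x~z (trans (sym eq) (sym (off z∉D (≢-sym (~⇒≢ x~z)))))

  module _ {D : Subset n} {x : V} (x∉D : x ∉ D) (x∉S : x ∉ₗ S) (room : Room D x) where
    open Room room

    -- One neighbour y may go unseen, provided its colour is foreign to L x or seen elsewhere; this makes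
    -- space for a second forbidden colour a.
    spare : ∀ {f y} → Colours D f → y ∉ D → y ∉ₗ S → x ~ y → ∀ a →
            f y ∉ₗ L x ⊎ (∃ λ y₂ → y₂ ∉ D × x ~ y₂ × y₂ ≢ y × f y₂ ≡ f y) →
            ∃ λ e → e ∈ₗ L x × e ≢ a × (∀ {z} → z ∉ D → x ~ z → f z ≢ e)
    spare {f} {y} Cf y∉D y∉S x~y a why =
      e , e∈L , (λ e≡a → e∉ (here e≡a)) , λ {z} z∉D x~z → case z ≟ y of λ
        { (yes refl) → avoid-y why ; (no z≢y) → avoid z∉D x~z z≢y }
      where
      others : List V
      others = filter (λ z → ¬? (z ≟ y)) seen
      cs : List ℕ
      cs = a ∷ map f others
      y∈seen : y ∈ₗ seen
      y∈seen = case cover y∉D x~y of λ { (inj₁ y∈) → y∈ ; (inj₂ (y∈S , _)) → contradiction y∈S y∉S }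
      sp : ∃ λ e → e ∈ₗ L x × e ∉ₗ cs
      sp = spare-colour (≤-trans (s≤s (≤-trans (≤-reflexive (cong suc (length-map f others))) (length-remove _≟_ y∈seen))) short)
      e : ℕ
      e = proj₁ sp
      e∈L : e ∈ₗ L x
      e∈L = proj₁ (proj₂ sp)
      e∉ : e ∉ₗ cs
      e∉ = proj₂ (proj₂ sp)
      avoid-seen : ∀ {z} → z ∈ₗ seen → z ≢ y → f z ≢ e
      avoid-seen z∈ z≢y fz≡e = e∉ (there (subst (_∈ₗ map f _) fz≡e (∈-map⁺ f (∈-remove _≟_ z∈ z≢y))))
      avoid : ∀ {z} → z ∉ D → x ~ z → z ≢ y → f z ≢ e
      avoid z∉D x~z z≢y fz≡e with cover z∉D x~z
      ... | inj₁ z∈ = avoid-seen z∈ z≢y fz≡e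
      ... | inj₂ (z∈S , inj₁ σz∉) = σz∉ (subst (_∈ₗ L x) (trans (sym fz≡e) (fixed Cf z∈S)) e∈L)
      ... | inj₂ (z∈S , inj₂ (s , s∈S , s∈ , eq)) = avoid-seen s∈ (λ { refl → y∉S s∈S })
              (trans (fixed Cf s∈S) (trans eq (trans (sym (fixed Cf z∈S)) fz≡e)))
      avoid-y : _ → f y ≢ e
      avoid-y (inj₁ fy∉) fy≡e = fy∉ (subst (_∈ₗ L x) (sym fy≡e) e∈L)
      avoid-y (inj₂ (y₂ , y₂∉D , x~y₂ , y₂≢y , eq)) fy≡e = avoid y₂∉D x~y₂ y₂≢y (trans eq fy≡e)

    extend : ∀ {h} → Colours (D ∪ ⁅ x ⁆) h → ∃ (Colours D)
    extend {h} Ch = update h x e , update-colours Ch x∉S e∈L avoid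
      where
      sp : ∃ λ e → e ∈ₗ L x × e ∉ₗ map h seen
      sp = spare-colour (≤-trans (s≤s (≤-reflexive (length-map h seen))) short)
      e : ℕ
      e = proj₁ sp
      e∈L : e ∈ₗ L x
      e∈L = proj₁ (proj₂ sp)
      avoid-seen : ∀ {z} → z ∈ₗ seen → h z ≢ e
      avoid-seen z∈ eq = proj₂ (proj₂ sp) (subst (_∈ₗ map h seen) eq (∈-map⁺ h z∈))
      avoid : ∀ {z} → z ∉ D → x ~ z → h z ≢ e
      avoid z∉D x~z hz≡e with cover z∉D x~z
      ... | inj₁ z∈ = avoid-seen z∈ hz≡e
      ... | inj₂ (z∈S , inj₁ σz∉) = σz∉ (subst (_∈ₗ L x) (trans (sym hz≡e) (fixed Ch z∈S)) e∈L)
      ... | inj₂ (z∈S , inj₂ (s , s∈S , s∈ , eq)) =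
              avoid-seen s∈ (trans (fixed Ch s∈S) (trans eq (trans (sym (fixed Ch z∈S)) hz≡e)))

    module _ {h₀ h₁ : Coloring G} (Ch₀ : Colours (D ∪ ⁅ x ⁆) h₀) (Ch₁ : Colours (D ∪ ⁅ x ⁆) h₁)
             (st : Step (D ∪ ⁅ x ⁆) h₀ h₁) where
      open Step st

      record Lift (f : Coloring G) : Set where
        field
          target  : Coloring G
          colours : Colours D target
          steps   : Star (Link D) f target
          agrees  : ∀ {w} → w ∉ D → w ≢ x → target w ≡ h₁ w

      module _ {f : Coloring G} (Cf : Colours D f) (f≗h₀ : ∀ {w} → w ∉ D → w ≢ x → f w ≡ h₀ w) where

        private
          K-∉D : ∀ {w} → w ∈ K → w ∉ D
          K-∉D w∈K = ∉∪ˡ (alive w∈K)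

          K-≢x : ∀ {w} → w ∈ K → w ≢ x
          K-≢x w∈K = ∉∪ʳ (alive w∈K)

          AB₀ : ∀ {w} → w ∉ D → w ≢ x → ColoredAB G f a b w → ColoredAB G h₀ a b w
          AB₀ w∉D w≢x = subst (λ c → c ≡ a ⊎ c ≡ b) (f≗h₀ w∉D w≢x)

          in-K : ∀ {w} → w ∈ K → h₁ w ≡ swapCol G a b (f w)
          in-K w∈K = trans (inside w∈K) (cong (swapCol G a b) (sym (f≗h₀ (K-∉D w∈K) (K-≢x w∈K))))

          off-K : ∀ {w} → w ∉ D → w ≢ x → w ∉ K → h₁ w ≡ f w
          off-K w∉D w≢x w∉K = trans (outside (∉∪ w∉D w≢x) w∉K) (sym (f≗h₀ w∉D w≢x))

          uncoloured : ∀ {w} → w ∉ D → w ≢ x → ¬ ColoredAB G f a b w → h₁ w ≡ f w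
          uncoloured {w} w∉D w≢x ¬ab = case w ∈? K of λ
            { (yes w∈K) → trans (in-K w∈K) (swap-other ¬ab) ; (no w∉K) → off-K w∉D w≢x w∉K }

          K-closed : ∀ {y z} → y ∈ K → z ∉ D → z ≢ x → y ~ z → ColoredAB G f a b y → ColoredAB G f a b z → z ∈ K
          K-closed y∈K z∉D z≢x y~z aby abz =
            closed y∈K (∉∪ z∉D z≢x) y~z (AB₀ (K-∉D y∈K) (K-≢x y∈K) aby) (AB₀ z∉D z≢x abz)

        -- No edge with both ends coloured `a` or `b` joins `x` to `K`, so `K` stays closed when `x`
        -- returns, and `x` keeps its colour.
        lift-apart : (∀ {y} → y ∈ K → x ~ y → ColoredAB G f a b y → ¬ ColoredAB G f a b x) → Lift f
        lift-apart apart = record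
          { target = f₁ ; colours = Cf₁ ; agrees = λ _ w≢x → update-neq h₁ (f x) w≢x
          ; steps = (Cf , Cf₁ , record
              { a = a ; b = b ; K = K ; alive = K-∉D ; free = free
              ; inside  = λ w∈K → trans (update-neq h₁ (f x) (K-≢x w∈K)) (in-K w∈K)
              ; outside = λ {w} w∉D w∉K → case w ≟ x of λ
                  { (yes refl) → update-eq h₁ x (f x)
                  ; (no w≢x)   → trans (update-neq h₁ (f x) w≢x) (off-K w∉D w≢x w∉K) }
              ; closed  = λ {y} {z} y∈K z∉D y~z aby abz → case z ≟ x of λ
                  { (yes refl) → contradiction abz (apart y∈K (~-sym y~z) aby)
                  ; (no z≢x)   → K-closed y∈K z∉D z≢x y~z aby abz } }) ◅ ε }
          where
          f₁ : Coloring G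
          f₁ = update h₁ x (f x)
          avoid : ∀ {z} → z ∉ D → x ~ z → h₁ z ≢ f x
          avoid {z} z∉D x~z eq with z ∈? K | Coloured? f a b z
          ... | no z∉K  | _       = proper Cf x∉D z∉D x~z (trans (sym eq) (off-K z∉D (≢-sym (~⇒≢ x~z)) z∉K))
          ... | yes _   | no ¬ab  = proper Cf x∉D z∉D x~z (trans (sym eq) (uncoloured z∉D (≢-sym (~⇒≢ x~z)) ¬ab))
          ... | yes z∈K | yes abz = apart z∈K x~z abz
                (subst (λ c → c ≡ a ⊎ c ≡ b) (trans (sym (in-K z∈K)) eq) (swap-coloured abz))
          Cf₁ : Colours D f₁
          Cf₁ = update-colours Ch₁ x∉S (list Cf x∉D) avoid

        -- `x` is swapped along with `K`: its new colour is in its list, and none of its neighbours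
        -- coloured `a` or `b` stays behind with that colour.
        lift-join : ColoredAB G f a b x → swapCol G a b (f x) ∈ₗ L x →
                    (∀ {z} → z ∉ D → x ~ z → ColoredAB G f a b z → z ∈ K) → Lift f
        lift-join abx e∈L joined = record
          { target = f₁ ; colours = Cf₁ ; agrees = λ _ w≢x → update-neq h₁ e w≢x
          ; steps = (Cf , Cf₁ , record
              { a = a ; b = b ; K = K ∪ ⁅ x ⁆
              ; alive   = λ w∈ → by-cases w∈ K-∉D (λ { refl → x∉D })
              ; free    = λ w∈ → by-cases w∈ free (λ { refl → x∉S })
              ; inside  = λ w∈ → by-cases w∈ (λ w∈K → trans (update-neq h₁ e (K-≢x w∈K)) (in-K w∈K))
                                             (λ { refl → update-eq h₁ x e })
              ; outside = λ {w} w∉D w∉ → trans (update-neq h₁ e (∉∪ʳ w∉)) (off-K w∉D (∉∪ʳ w∉) (∉∪ˡ w∉))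
              ; closed  = λ {y} {z} y∈ z∉D y~z aby abz → case z ≟ x of λ
                  { (yes refl) → x∈p∪q⁺ (inj₂ (x∈⁅x⁆ x))
                  ; (no z≢x)   → p⊆p∪q _ (by-cases y∈ (λ y∈K → K-closed y∈K z∉D z≢x y~z aby abz)
                                                      (λ { refl → joined z∉D y~z abz })) } }) ◅ ε }
          where
          e : ℕ
          e = swapCol G a b (f x)
          f₁ : Coloring G
          f₁ = update h₁ x e
          by-cases : ∀ {w} {A : Set} → w ∈ K ∪ ⁅ x ⁆ → (w ∈ K → A) → (w ≡ x → A) → A
          by-cases w∈ k₁ k₂ = [ k₁ , (λ w∈x → k₂ (x∈⁅y⁆⇒x≡y x w∈x)) ]′ (x∈p∪q⁻ K ⁅ x ⁆ w∈)
          avoid : ∀ {z} → z ∉ D → x ~ z → h₁ z ≢ e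
          avoid {z} z∉D x~z eq with Coloured? f a b z
          ... | yes abz = proper Cf x∉D z∉D x~z (sym (swap-injective a b (trans (sym (in-K (joined z∉D x~z abz))) eq)))
          ... | no ¬ab  = ¬ab (subst (λ c → c ≡ a ⊎ c ≡ b)
                                 (trans (sym eq) (uncoloured z∉D (≢-sym (~⇒≢ x~z)) ¬ab)) (swap-coloured abx))
          Cf₁ : Colours D f₁
          Cf₁ = update-colours Ch₁ x∉S e∈L avoid

      other-colour : ∀ {c d} → c ≡ a ⊎ c ≡ b → d ≡ a ⊎ d ≡ b → d ≢ c → d ≡ swapCol G a b c
      other-colour (inj₁ c≡a) (inj₁ d≡a) d≢c = contradiction (trans d≡a (sym c≡a)) d≢c
      other-colour (inj₁ c≡a) (inj₂ d≡b) d≢c = trans d≡b (sym (swap-fst c≡a))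
      other-colour (inj₂ c≡b) (inj₁ d≡a) d≢c = trans d≡a (sym (swap-snd c≡b))
      other-colour (inj₂ c≡b) (inj₂ d≡b) d≢c = contradiction (trans d≡b (sym c≡b)) d≢c

      opposite : ∀ {f y} → Colours D f → y ∉ D → x ~ y → ColoredAB G f a b x → ColoredAB G f a b y → f y ≡ swapCol G a b (f x)
      opposite Cf y∉D x~y abx aby = other-colour abx aby (≢-sym (proper Cf x∉D y∉D x~y))

      -- The spare colour differs from that of `x` and from that of `y`, which together are `a` and
      -- `b`; after the recolouring `x` no longer interferes with the swap.
      lift-away : ∀ {f y} → Colours D f → (∀ {w} → w ∉ D → w ≢ x → f w ≡ h₀ w) →
                  y ∈ K → x ~ y → ColoredAB G f a b x → ColoredAB G f a b y →
                  f y ∉ₗ L x ⊎ (∃ λ y₂ → y₂ ∉ D × x ~ y₂ × y₂ ≢ y × f y₂ ≡ f y) → Lift f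
      lift-away {f} {y} Cf f≗h₀ y∈K x~y abx aby why = record
        { target = Lift.target l ; colours = Lift.colours l ; agrees = Lift.agrees l
        ; steps  = recolour-link x∉D x∉S Cf Cf′ (λ _ w≢x → update-neq f e w≢x) ◅ Lift.steps l }
        where
        y∉D : y ∉ D
        y∉D = ∉∪ˡ (alive y∈K)
        sp : ∃ λ e → e ∈ₗ L x × e ≢ f x × (∀ {z} → z ∉ D → x ~ z → f z ≢ e)
        sp = spare Cf y∉D (free y∈K) x~y (f x) why
        e : ℕ
        e = proj₁ sp
        e≢fx : e ≢ f x
        e≢fx = proj₁ (proj₂ (proj₂ sp))
        avoid : ∀ {z} → z ∉ D → x ~ z → f z ≢ e
        avoid = proj₂ (proj₂ (proj₂ sp))
        f′ : Coloring G
        f′ = update f x e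
        Cf′ : Colours D f′
        Cf′ = update-colours (weaken Cf) x∉S (proj₁ (proj₂ sp)) avoid
        ¬abe : ¬ (e ≡ a ⊎ e ≡ b)
        ¬abe abe = avoid y∉D x~y (trans (opposite Cf y∉D x~y abx aby) (sym (other-colour abx abe e≢fx)))
        l : Lift f′
        l = lift-apart Cf′ (λ w∉D w≢x → trans (update-neq f e w≢x) (f≗h₀ w∉D w≢x))
              λ _ _ _ abx′ → ¬abe (subst (λ c → c ≡ a ⊎ c ≡ b) (update-eq f x e) abx′)

      -- If x blocks the swap, then it first moves to a colour outside {a, b}.
      lift : ∀ {f} → Colours D f → (∀ {w} → w ∉ D → w ≢ x → f w ≡ h₀ w) → Lift f
      lift {f} Cf f≗h₀ with Coloured? f a b x
      ... | no ¬abx = lift-apart Cf f≗h₀ λ _ _ _ → ¬abx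
      ... | yes abx with any? (λ y → (y ∈? K) ×-dec (x ~? y) ×-dec Coloured? f a b y)
      ...   | no none = lift-apart Cf f≗h₀ λ y∈K x~y aby _ → none (_ , y∈K , x~y , aby)
      ...   | yes (y , y∈K , x~y , aby)
        with swapCol G a b (f x) ∈ᶜ? L x
           | any? (λ y₂ → ¬? (y₂ ∈? D) ×-dec (x ~? y₂) ×-dec Coloured? f a b y₂ ×-dec ¬? (y₂ ∈? K))
      ...     | yes e∈L | no none = lift-join Cf f≗h₀ abx e∈L λ {z} z∉D x~z abz →
                  decidable-stable (z ∈? K) λ z∉K → none (z , z∉D , x~z , abz , z∉K)
      ...     | no e∉L  | _ = lift-away Cf f≗h₀ y∈K x~y abx aby
                  (inj₁ (subst (_∉ₗ L x) (sym (opposite Cf (∉∪ˡ (alive y∈K)) x~y abx aby)) e∉L))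
      ...     | yes _   | yes (y₂ , y₂∉D , x~y₂ , aby₂ , y₂∉K) = lift-away Cf f≗h₀ y∈K x~y abx aby
                  (inj₂ (y₂ , y₂∉D , x~y₂ , (λ { refl → y₂∉K y∈K })
                        , trans (opposite Cf y₂∉D x~y₂ abx aby₂) (sym (opposite Cf (∉∪ˡ (alive y∈K)) x~y abx aby))))

    lift-all : ∀ {f h₀ h₁} → Star (Link (D ∪ ⁅ x ⁆)) h₀ h₁ → Colours D f → (∀ {w} → w ∉ D → w ≢ x → f w ≡ h₀ w) →
               ∃ λ f₁ → Star (Link D) f f₁ × Colours D f₁ × (∀ {w} → w ∉ D → w ≢ x → f₁ w ≡ h₁ w)
    lift-all ε Cf f≗h₀ = _ , ε , Cf , f≗h₀
    lift-all ((C₀ , C₁ , st) ◅ rest) Cf f≗h₀ =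
      let l = lift C₀ C₁ st Cf f≗h₀
          f₁ , steps , Cf₁ , agrees = lift-all rest (Lift.colours l) (Lift.agrees l)
      in f₁ , Lift.steps l ◅◅ steps , Cf₁ , agrees

  data Order (D : Subset n) : Set where
    done : (∀ {w} → w ∉ D → w ∈ₗ S) → Order D
    next : ∀ {x} → x ∉ D → x ∉ₗ S → Room D x → Order (D ∪ ⁅ x ⁆) → Order D

  -- Without `x` the two colourings are joined by induction. The lifted sequence starts at `f` and
  -- ends at a colouring that differs from `g` at most at `x`, so one recolouring finishes.
  connect : ∀ {D f g} → Order D → Colours D f → Colours D g → Star (Link D) f g
  connect (done all-S) Cf Cg =
    ≗-link Cf Cg (λ w∉D → trans (fixed Cg (all-S w∉D)) (sym (fixed Cf (all-S w∉D)))) ◅ ε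
  connect (next x∉D x∉S room order) Cf Cg =
    let f₁ , steps , Cf₁ , agrees = lift-all x∉D x∉S room (connect order (weaken Cf) (weaken Cg)) Cf (λ _ _ → refl)
    in steps ◅◅ recolour-link x∉D x∉S Cf₁ Cg (λ w∉D w≢x → sym (agrees w∉D w≢x)) ◅ ε

  -- `reach` asks for a slack vertex in each component of G - S rather than for connectedness, since
  -- four precoloured vertices may separate G.
  record Precolouring : Set where
    field
      proper : ∀ {y z} → y ∈ₗ S → z ∈ₗ S → y ~ z → σ y ≢ σ z
      list   : ∀ {y} → y ∈ₗ S → σ y ∈ₗ L y
      reach  : ∀ {w} → w ∉ₗ S → ∃ λ u → Slack ∅ u × PathIn G (_∉ₗ S) w u

  Slack-mono : ∀ {D u} → Slack ∅ u → Slack D u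
  Slack-mono (surplus d)              = surplus d
  Slack-mono (deleted _ t∈)           = ⊥-elim (∉⊥ t∈)
  Slack-mono (foreign e s∈ σ∉)        = foreign e s∈ σ∉
  Slack-mono (repeat e e′ ne s∈ t∈ q) = repeat e e′ ne s∈ t∈ q

  module _ (pre : Precolouring) where
    open Precolouring pre using (reach)

    order : ∀ D → Acc _⊃_ D → Order D
    order D (acc rec) with any? (λ w → ¬? (w ∈? D) ×-dec ¬? (w ∈ᵛ? S))
    ... | no none = done λ {w} w∉D → decidable-stable (w ∈ᵛ? S) λ w∉S → none (w , w∉D , w∉S)
    ... | yes (w , w∉D , w∉S) = let x , x∉D , x∉S , slack = removable (reach w∉S) in
      next x∉D x∉S (Slack⇒Room slack)
        (order (D ∪ ⁅ x ⁆) (rec ((λ {_} → p⊆p∪q _) , x , x∈p∪q⁺ (inj₂ (x∈⁅x⁆ x)) , x∉D)))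
      where
      -- If the slack vertex `u` is itself deleted, then the path from `w` to it meets `D`, and the
      -- vertex just before has a deleted neighbour.
      removable : (∃ λ u → Slack ∅ u × PathIn G (_∉ₗ S) w u) → ∃ λ x → x ∉ D × x ∉ₗ S × Slack D x
      removable (u , slack , p) with u ∈? D
      ... | no u∉D  = u , u∉D , path-end p , Slack-mono slack
      ... | yes u∈D = let x , y , q , x~y , y∉S , ¬y∉D = path-exit (λ t → ¬? (t ∈? D)) p w∉D (λ u∉D → u∉D u∈D)
                      in x , proj₂ (path-end q) , proj₁ (path-end q) , deleted x~y (decidable-stable (y ∈? D) ¬y∉D)

    extension : ∃ λ φ → IsLColoring G L φ × (∀ {s} → s ∈ₗ S → φ s ≡ σ s)
    extension = let f , Cf = go (order ∅ (⊃-wellFounded ∅)) in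
      f , ((λ y z y~z → proper Cf ∉⊥ ∉⊥ y~z) , (λ y → list Cf ∉⊥)) , fixed Cf
      where
      go : ∀ {D} → Order D → ∃ (Colours D)
      go (done all-S) = σ , record
        { proper = λ y∉ z∉ → Precolouring.proper pre (all-S y∉) (all-S z∉)
        ; list = λ y∉ → Precolouring.list pre (all-S y∉) ; fixed = λ _ → refl }
      go (next x∉D x∉S room order) = extend x∉D x∉S room (proj₂ (go order))

    extensions-equivalent : ∀ {φ ψ} → V → IsLColoring G L φ → IsLColoring G L ψ →
                            (∀ {s} → s ∈ₗ S → φ s ≡ σ s) → (∀ {s} → s ∈ₗ S → ψ s ≡ σ s) → LEquivalent G L φ ψ
    extensions-equivalent v Lφ Lψ φ-ext ψ-ext =
      realise (connect (order ∅ (⊃-wellFounded ∅)) (colours Lφ φ-ext) (colours Lψ ψ-ext))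
      where
      colours : ∀ {f} → IsLColoring G L f → (∀ {s} → s ∈ₗ S → f s ≡ σ s) → Colours ∅ f
      colours (pr , li) ext = record { proper = λ _ _ → pr _ _ ; list = λ _ → li _ ; fixed = ext }
      isL : ∀ {f} → Colours ∅ f → IsLColoring G L f
      isL Cf = (λ y z → proper Cf ∉⊥ ∉⊥) , (λ y → list Cf ∉⊥)
      realise : ∀ {f g} → Star (Link ∅) f g → LEquivalent G L f g
      realise ε = ε
      realise ((Cf , Cg , st) ◅ rest) = SwapOn⇒LEquivalent L v (isL Cf) (isL Cg) (record
        { inside = Step.inside st ; outside = Step.outside st ∉⊥
        ; closed = λ y∈ → Step.closed st y∈ ∉⊥ }) ◅◅ realise rest

-- Deleting at most three vertices.

∣⁅x⁆∪p∣≤1+∣p∣ : ∀ {m} (x : Fin m) (p : Subset m) → ∣ ⁅ x ⁆ ∪ p ∣ ≤ suc ∣ p ∣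
∣⁅x⁆∪p∣≤1+∣p∣ Fin.zero    (s ∷ p)       = subst (λ q → suc ∣ q ∣ ≤ suc ∣ s ∷ p ∣) (sym (∪-identityˡ p)) (s≤s (∣p∣≤∣x∷p∣ s p))
∣⁅x⁆∪p∣≤1+∣p∣ (Fin.suc x) (true ∷ p)  = s≤s (∣⁅x⁆∪p∣≤1+∣p∣ x p)
∣⁅x⁆∪p∣≤1+∣p∣ (Fin.suc x) (false ∷ p) = ∣⁅x⁆∪p∣≤1+∣p∣ x p

module FourConnected (G : Graph) (κ : KConnected G 4) where
  open Paths G

  private
    fromList : List V → Subset n
    fromList []       = ∅
    fromList (x ∷ xs) = ⁅ x ⁆ ∪ fromList xs

    ∣fromList∣ : ∀ xs → ∣ fromList xs ∣ ≤ length xs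
    ∣fromList∣ []       = ≤-reflexive (∣⊥∣≡0 n)
    ∣fromList∣ (x ∷ xs) = ≤-trans (∣⁅x⁆∪p∣≤1+∣p∣ x (fromList xs)) (s≤s (∣fromList∣ xs))

    ∈-fromList⁺ : ∀ {xs v} → v ∈ₗ xs → v ∈ fromList xs
    ∈-fromList⁺ {v ∷ xs} (here refl) = x∈p∪q⁺ (inj₁ (x∈⁅x⁆ v))
    ∈-fromList⁺          (there v∈)  = x∈p∪q⁺ (inj₂ (∈-fromList⁺ v∈))

    ∈-fromList⁻ : ∀ {xs v} → v ∈ fromList xs → v ∈ₗ xs
    ∈-fromList⁻ {[]}     v∈ = ⊥-elim (∉⊥ v∈)
    ∈-fromList⁻ {x ∷ xs} v∈ = [ (λ p → here (x∈⁅y⁆⇒x≡y x p)) , (λ p → there (∈-fromList⁻ p)) ]′ (x∈p∪q⁻ ⁅ x ⁆ (fromList xs) v∈)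

  connected : ∀ S {_ : True (length S <? 4)} {u v} → u ∉ₗ S → v ∉ₗ S → PathIn G (_∉ₗ S) u v
  connected S {S<4} u∉ v∉ =
    path-map (λ t∉ t∈ → t∉ (∈-fromList⁺ t∈))
      (proj₂ κ (fromList S) (≤-<-trans (∣fromList∣ S) (toWitness S<4)) _ _ (λ t → u∉ (∈-fromList⁻ t)) (λ t → v∉ (∈-fromList⁻ t)))

  another : ∀ S → length S < 5 → ∃ λ v → v ∉ₗ S
  another S S<5 =
    let v , _ , v∉S = pigeonhole _≟_ (allFin⁺ n) (≤-trans S<5 (≤-trans (proj₁ κ) (≤-reflexive (sym (length-tabulate {n = n} (λ i → i))))))
    in v , v∉S

  -- There are at least five vertices, hence one outside `v ∷ S`; a path to it that avoids `S`
  -- starts with the wanted edge.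
  fresh-nbr : ∀ S {_ : True (length S <? 4)} {v} → v ∉ₗ S → ∃ λ w → v ~ w × w ∉ₗ S
  fresh-nbr S {S<4} {v} v∉S =
    let w , w∉ = another (v ∷ S) (s≤s (toWitness S<4)) in first w∉ (connected S {S<4} v∉S (λ w∈S → w∉ (there w∈S)))
    where
    first : ∀ {w} → w ∉ₗ v ∷ S → PathIn G (_∉ₗ S) v w → ∃ λ x → v ~ x × x ∉ₗ S
    first w∉ (here _)     = contradiction (here refl) w∉
    first w∉ (step _ e p) = _ , e , path-start p

-- Classes of precolourings and their witnesses.

module Precolour (G : Graph) (κ : KConnected G 4) (L : ListAssignment G) (deg : IsDegreeAssignment G L) where
  open Paths G
  open Lists G L public
  open FourConnected G κ public
  open Extension using (Slack; surplus; foreign; repeat) public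

  infix 4 _≈_
  _≈_ : Coloring G → Coloring G → Set
  φ ≈ ψ = LEquivalent G L φ ψ

  IsL : Coloring G → Set
  IsL = IsLColoring G L

  _slackAt_under_ : List V → V → Coloring G → Set
  S slackAt u under σ = Slack G L deg S σ ∅ u

  some-vertex : V
  some-vertex = proj₁ (another [] (s≤s z≤n))

  extend≤3 : ∀ S (σ : Coloring G) {_ : True (length S <? 4)} {u} → u ∉ₗ S → S slackAt u under σ →
             (∀ {y z} → y ∈ₗ S → z ∈ₗ S → y ~ z → σ y ≢ σ z) → (∀ {y} → y ∈ₗ S → σ y ∈ₗ L y) →
             ∃ λ φ → IsL φ × (∀ {s} → s ∈ₗ S → φ s ≡ σ s)
  extend≤3 S σ {S<4} u∉S slack proper list = Extension.extension G L deg S σ record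
    { proper = proper ; list = list ; reach = λ w∉S → _ , slack , connected S {S<4} w∉S u∉S }

  agree≤3 : ∀ S {_ : True (length S <? 4)} {u φ ψ} → IsL φ → IsL ψ → (∀ {s} → s ∈ₗ S → ψ s ≡ φ s) →
            u ∉ₗ S → S slackAt u under φ → φ ≈ ψ
  agree≤3 S {S<4} Lφ Lψ ψ≗φ u∉S slack = Extension.extensions-equivalent G L deg S _ record
    { proper = λ _ _ → proj₁ Lφ _ _ ; list = λ _ → proj₂ Lφ _ ; reach = λ w∉S → _ , slack , connected S {S<4} w∉S u∉S }
    some-vertex Lφ Lψ (λ _ → refl) ψ≗φ

  foreign-class : ∀ {y x φ ψ} → IsL φ → IsL ψ → y ~ x → φ y ∉ₗ L x → ψ y ≡ φ y → φ ≈ ψ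
  foreign-class {y} Lφ Lψ y~x φy∉ eq = agree≤3 (y ∷ []) Lφ Lψ (λ { (here refl) → eq })
    (λ { (here refl) → ~-irrefl y~x }) (foreign (~-sym y~x) (here refl) φy∉)

  repeat-class : ∀ {y z x φ ψ} → IsL φ → IsL ψ → y ~ x → z ~ x → y ≢ z → φ y ≡ φ z → ψ y ≡ φ y → ψ z ≡ φ z → φ ≈ ψ
  repeat-class {y} {z} Lφ Lψ y~x z~x y≢z eq eqy eqz = agree≤3 (y ∷ z ∷ []) Lφ Lψ
    (λ { (here refl) → eqy ; (there (here refl)) → eqz })
    (λ { (here refl) → ~-irrefl y~x ; (there (here refl)) → ~-irrefl z~x })
    (repeat (~-sym y~x) (~-sym z~x) y≢z (here refl) (there (here refl)) eq)

  data Witness (φ : Coloring G) (u : V) : Set where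
    alien : ∀ s → s ~ u → φ s ∉ₗ L u → Witness φ u
    twins : ∀ s t → s ~ u → t ~ u → s ≢ t → φ s ≡ φ t → Witness φ u

  -- Otherwise u and its neighbours would carry 1 + degree u distinct colours of L u.
  witness : (∀ v → size v ≤ degree G v) → ∀ {φ} → IsL φ → ∀ u → Witness φ u
  witness tight {φ} Lφ u with any? (λ s → (s ~? u) ×-dec ¬? (φ s ∈ᶜ? L u))
  ... | yes (s , s~u , φs∉) = alien s s~u φs∉
  ... | no no-alien with any? (λ s → any? (λ t → (s ~? u) ×-dec (t ~? u) ×-dec ¬? (s ≟ t) ×-dec (φ s ℕ.≟ φ t)))
  ...   | yes (s , t , s~u , t~u , s≢t , eq) = twins s t s~u t~u s≢t eq
  ...   | no no-twins = contradiction (tight u) (<⇒≱ (≤-trans (s≤s (≤-reflexive (sym (length-map φ (nbrs u)))))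
                          (Unique⇒length≤ ℕ._≟_ (All.tabulate φu∉ ∷ map-unique (filter⁺ _ (allFin⁺ n)) (λ p → p)) sub)))
    where
    φu∉ : ∀ {c} → c ∈ₗ map φ (nbrs u) → φ u ≢ c
    φu∉ c∈ eq = let s , s∈ , c≡φs = ∈-map⁻ φ c∈ in proj₁ Lφ u s (∈-nbrs⁻ s∈) (trans eq c≡φs)
    map-unique : ∀ {vs} → Unique vs → (∀ {s} → s ∈ₗ vs → s ∈ₗ nbrs u) → Unique (map φ vs)
    map-unique [] _ = []
    map-unique (v∉ ∷ uniq) vs⊆ = All.tabulate (λ c∈ eq →
        let t , t∈ , c≡φt = ∈-map⁻ φ c∈
        in no-twins (_ , t , ~-sym (∈-nbrs⁻ (vs⊆ (here refl))) , ~-sym (∈-nbrs⁻ (vs⊆ (there t∈)))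
                    , All.lookup v∉ t∈ , trans eq c≡φt))
      ∷ map-unique uniq (λ p → vs⊆ (there p))
    sub : ∀ {c} → c ∈ₗ φ u ∷ map φ (nbrs u) → c ∈ₗ deduplicate ℕ._≟_ (L u)
    sub (here refl) = ∈-deduplicate⁺ ℕ._≟_ (proj₂ Lφ u)
    sub (there c∈) = let s , s∈ , c≡φs = ∈-map⁻ φ c∈ in ∈-deduplicate⁺ ℕ._≟_
      (subst (_∈ₗ L u) (sym c≡φs) (decidable-stable (φ s ∈ᶜ? L u) λ φs∉ → no-alien (s , ~-sym (∈-nbrs⁻ s∈) , φs∉)))

  -- Connectivity provides three neighbours, hence three colours, of which two are excluded.
  another-colour : ∀ c d v → ∃ λ m → m ∈ₗ L v × m ≢ c × m ≢ d
  another-colour c d v =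
    let m , m∈ , m∉ = spare-colour {v} {c ∷ d ∷ []} (≤-trans three≤deg (deg v))
    in m , m∈ , (λ m≡c → m∉ (here m≡c)) , (λ m≡d → m∉ (there (here m≡d)))
    where
    three≤deg : 3 ≤ degree G v
    three≤deg =
      let x , v~x , _  = fresh-nbr [] {v = v} (λ ())
          y , v~y , y∉ = fresh-nbr (x ∷ []) {v = v} (λ { (here v≡x) → ~⇒≢ v~x v≡x })
          z , v~z , z∉ = fresh-nbr (x ∷ y ∷ []) {v = v} (λ { (here v≡x) → ~⇒≢ v~x v≡x ; (there (here v≡y)) → ~⇒≢ v~y v≡y })
      in Unique⇒length≤ _≟_ {x ∷ y ∷ z ∷ []}
           (((λ x≡y → y∉ (here (sym x≡y))) ∷ (λ x≡z → z∉ (here (sym x≡z))) ∷ [])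
             ∷ ((λ y≡z → z∉ (there (here (sym y≡z)))) ∷ []) ∷ [] ∷ [])
           λ { (here refl) → ∈-nbrs v~x ; (there (here refl)) → ∈-nbrs v~y ; (there (there (here refl))) → ∈-nbrs v~z }

-- Lists that are not all equal.

module NonIdentical (G : Graph) (κ : KConnected G 4) (L : ListAssignment G) (deg : IsDegreeAssignment G L)
                    (tight : ∀ v → Lists.size G L v ≤ degree G v) (¬complete : ¬ Complete G) where
  open Paths G
  open Swaps G
  open Precolour G κ L deg

  record Boundary (c : ℕ) (w : V) : Set where
    constructor boundary
    field
      {outer} : V
      edge    : w ~ outer
      has     : c ∈ₗ L w
      lacks   : c ∉ₗ L outer
  open Boundary

  boundary-class : ∀ {c w φ ψ} → Boundary c w → IsL φ → IsL ψ → φ w ≡ c → ψ w ≡ c → φ ≈ ψ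
  boundary-class (boundary edge _ lacks) Lφ Lψ refl eq = foreign-class Lφ Lψ edge lacks eq

  module _ {c w} (∂w : Boundary c w) where

    colour-boundary : ∀ S (φ : Coloring G) {_ : True (length (w ∷ S) <? 4)} {u} → w ∉ₗ S → u ∉ₗ w ∷ S →
                      (w ∷ S) slackAt u under update φ w c →
                      (∀ {y z} → y ∈ₗ S → z ∈ₗ S → y ~ z → φ y ≢ φ z) → (∀ {y} → y ∈ₗ S → φ y ∈ₗ L y) →
                      (∀ {y} → y ∈ₗ S → y ~ w → φ y ≢ c) →
                      ∃ λ χ → IsL χ × χ w ≡ c × (∀ {y} → y ∈ₗ S → χ y ≡ φ y)
    colour-boundary S φ {S<} w∉S u∉ slack proper list avoid =
      let χ , Lχ , χ≗ = extend≤3 (w ∷ S) (update φ w c) {S<} u∉ slack proper′ list′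
      in χ , Lχ , trans (χ≗ (here refl)) (update-eq φ w c) , λ y∈ → trans (χ≗ (there y∈)) (off y∈)
      where
      off : ∀ {y} → y ∈ₗ S → update φ w c y ≡ φ y
      off y∈ = update-neq φ c λ { refl → w∉S y∈ }
      proper′ : ∀ {y z} → y ∈ₗ w ∷ S → z ∈ₗ w ∷ S → y ~ z → update φ w c y ≢ update φ w c z
      proper′ (here refl) (here refl) y~z _  = ~-irrefl y~z
      proper′ (here refl) (there z∈)  y~z eq = avoid z∈ (~-sym y~z) (trans (sym (off z∈)) (trans (sym eq) (update-eq φ w c)))
      proper′ (there y∈)  (here refl) y~z eq = avoid y∈ y~z (trans (sym (off y∈)) (trans eq (update-eq φ w c)))
      proper′ (there y∈)  (there z∈)  y~z eq = proper y∈ z∈ y~z (trans (sym (off y∈)) (trans eq (off z∈)))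
      list′ : ∀ {y} → y ∈ₗ w ∷ S → update φ w c y ∈ₗ L y
      list′ (here refl) = subst (_∈ₗ L w) (sym (update-eq φ w c)) (has ∂w)
      list′ (there y∈)  = subst (_∈ₗ L _) (sym (off y∈)) (list y∈)

    -- Colour `m` on `y` determines a class by itself, being foreign to `x`. The class is thus
    -- reached from `w`, and equally from any other boundary vertex away from `y` and `x`.
    bridge-foreign : ∀ {y x m} → y ~ x → m ∈ₗ L y → m ∉ₗ L x → y ≢ w → x ≢ w → m ≢ c →
                     ∃ λ χ → IsL χ × χ w ≡ c × χ y ≡ m
    bridge-foreign {y} {x} {m} y~x m∈ m∉ y≢w x≢w m≢c =
      let χ , Lχ , χw , χ≗ = colour-boundary (y ∷ []) (λ _ → m) (λ { (here w≡y) → y≢w (sym w≡y) })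
                   (λ { (here x≡w) → x≢w x≡w ; (there (here refl)) → ~-irrefl y~x })
                   (foreign (~-sym y~x) (there (here refl)) (subst (_∉ₗ L x) (sym (update-neq (λ _ → m) c y≢w)) m∉))
                   (λ { (here refl) (here refl) y~y _ → ~-irrefl y~y }) (λ { (here refl) → m∈ }) (λ _ _ → m≢c)
      in χ , Lχ , χw , χ≗ (here refl)

    bridge-twins : ∀ {y z x m} → y ~ x → z ~ x → y ≢ z → ¬ y ~ z → m ∈ₗ L y → m ∈ₗ L z →
                   y ≢ w → z ≢ w → x ≢ w → m ≢ c → ∃ λ χ → IsL χ × χ w ≡ c × χ y ≡ m × χ z ≡ m
    bridge-twins {y} {z} {x} {m} y~x z~x y≢z y≁z m∈y m∈z y≢w z≢w x≢w m≢c =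
      let χ , Lχ , χw , χ≗ = colour-boundary (y ∷ z ∷ []) (λ _ → m)
                   (λ { (here w≡y) → y≢w (sym w≡y) ; (there (here w≡z)) → z≢w (sym w≡z) })
                   (λ { (here x≡w) → x≢w x≡w ; (there (here refl)) → ~-irrefl y~x ; (there (there (here refl))) → ~-irrefl z~x })
                   (repeat (~-sym y~x) (~-sym z~x) y≢z (there (here refl)) (there (there (here refl)))
                     (trans (update-neq (λ _ → m) c y≢w) (sym (update-neq (λ _ → m) c z≢w))))
                   (λ { (here refl) (here refl) e _ → ~-irrefl e ; (here refl) (there (here refl)) e _ → y≁z e
                      ; (there (here refl)) (here refl) e _ → y≁z (~-sym e) ; (there (here refl)) (there (here refl)) e _ → ~-irrefl e })
                   (λ { (here refl) → m∈y ; (there (here refl)) → m∈z }) (λ _ _ → m≢c)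
      in χ , Lχ , χw , χ≗ (here refl) , χ≗ (there (here refl))

  -- What remains of the adjacent case once no bridge exists: G − {s, w} is a clique, on which the lists agree
  -- up to c.
  record Exceptional (c : ℕ) (s w : V) : Set where
    field
      constant : ∀ {y x m} → y ≢ s → y ≢ w → x ≢ s → x ≢ w → m ∈ₗ L y → m ≢ c → m ∈ₗ L x
      clique   : ∀ {y x} → y ≢ s → y ≢ w → x ≢ s → x ≢ w → y ≢ x → y ~ x

  Exceptional-sym : ∀ {c s w} → Exceptional c s w → Exceptional c w s
  Exceptional-sym ex = record
    { constant = λ a b c d → Exceptional.constant ex b a d c ; clique = λ a b c d → Exceptional.clique ex b a d c }

  module _ {c s w} (s~w : s ~ w) (∂s : Boundary c s) (∂w : Boundary c w) (ex : Exceptional c s w) where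
    open Exceptional ex

    private
      u : V
      u = outer ∂s

      u≢s : u ≢ s
      u≢s = ≢-sym (~⇒≢ (edge ∂s))

      u≢w : u ≢ w
      u≢w u≡w = lacks ∂s (subst (λ t → c ∈ₗ L t) (sym u≡w) (has ∂w))

      -- `L u` lacks `c`, the one colour on which the lists outside {s, w} may differ, so it is
      -- contained in all of them.
      size-min : ∀ {y} → y ≢ s → y ≢ w → size u ≤ size y
      size-min {y} y≢s y≢w = Unique⇒length≤ ℕ._≟_ (deduplicate-! (L u)) λ m∈ → let m∈u = ∈-deduplicate⁻ ℕ._≟_ (L u) m∈ in
        ∈-deduplicate⁺ ℕ._≟_ (constant u≢s u≢w y≢s y≢w m∈u λ m≡c → lacks ∂s (subst (_∈ₗ L u) m≡c m∈u))

    -- Otherwise `u` is adjacent to all other vertices. Its degree is at most |L u| ≤ |L y| ≤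
    -- `degree y` for each `y` outside {s, w}, so these are adjacent to everything too; with `s ~ w`
    -- the graph is complete.
    outer≁ : ¬ u ~ w
    outer≁ u~w = ¬complete λ a b a≢b → decidable-stable (a ~? b) (incomplete a b a≢b)
      where
      dominating : ∀ {t} → t ≢ u → u ~ t
      dominating {t} t≢u with t ≟ s | t ≟ w
      ... | yes refl | _        = ~-sym (edge ∂s)
      ... | no _     | yes refl = u~w
      ... | no t≢s   | no t≢w   = clique u≢s u≢w t≢s t≢w (≢-sym t≢u)
      full : ∀ {y z} → y ≢ s → y ≢ w → y ≢ z → ¬ ¬ y ~ z
      full {y} {z} y≢s y≢w y≢z y≁z = <⇒≱ (s≤s (≤-trans (Unique⇒length≤ _≟_ uniq sub) (s≤s deg-u≤deg-y))) ≤-refl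
        where
        deg-u≤deg-y : degree G u ≤ degree G y
        deg-u≤deg-y = ≤-trans (deg u) (≤-trans (size-min y≢s y≢w) (tight y))
        uniq : Unique (y ∷ z ∷ nbrs y)
        uniq = (y≢z ∷ All.tabulate (λ t∈ → ~⇒≢ (∈-nbrs⁻ t∈)))
             ∷ All.tabulate (λ { t∈ refl → y≁z (∈-nbrs⁻ t∈) }) ∷ filter⁺ _ (allFin⁺ n)
        sub : ∀ {t} → t ∈ₗ y ∷ z ∷ nbrs y → t ∈ₗ u ∷ nbrs u
        sub {t} _ with t ≟ u
        ... | yes refl = here refl
        ... | no t≢u   = there (∈-nbrs (dominating t≢u))
      incomplete : ∀ a b → a ≢ b → ¬ ¬ a ~ b
      incomplete a b a≢b a≁b with a ≟ s | a ≟ w | b ≟ s | b ≟ w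
      ... | no a≢s   | no a≢w   | _        | _        = full a≢s a≢w a≢b a≁b
      ... | _        | _        | no b≢s   | no b≢w   = full b≢s b≢w (≢-sym a≢b) (≁-sym a≁b)
      ... | yes refl | _        | yes refl | _        = a≢b refl
      ... | yes refl | _        | _        | yes refl = a≁b s~w
      ... | _        | yes refl | yes refl | _        = a≁b (~-sym s~w)
      ... | _        | yes refl | _        | yes refl = a≢b refl

  outer≢ : ∀ {c w s} (∂w : Boundary c w) → Boundary c s → outer ∂w ≢ s
  outer≢ {c} ∂w ∂s eq = lacks ∂w (subst (λ t → c ∈ₗ L t) (sym eq) (has ∂s))

  -- A colour m ≠ c of s gives slack at a vertex x of the clique: m is foreign to x, or it can be repeated on
  -- the clique vertex v, which is not adjacent to s.
  record Half (s w u v : V) (m : ℕ) : Set where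
    field
      T       : List V
      short   : length T ≤ 2
      root    : s ∈ₗ T
      members : ∀ {t} → t ∈ₗ T → t ≡ s ⊎ t ≡ v
      lists   : ∀ {t} → t ∈ₗ T → m ∈ₗ L t
      x       : V
      x≢s     : x ≢ s
      x≢w     : x ≢ w
      x≢u     : x ≢ u
      x≢v     : x ≢ v
      slack   : ∀ {S σ} → (∀ {t} → t ∈ₗ T → t ∈ₗ S) → (∀ {t} → t ∈ₗ T → σ t ≡ m) → S slackAt x under σ

  module _ {c s w} (s~w : s ~ w) (∂s : Boundary c s) (∂w : Boundary c w) (ex : Exceptional c s w) where
    open Exceptional ex

    private
      u v : V
      u = outer ∂s
      v = outer ∂w

      v≁s : ¬ v ~ s
      v≁s = outer≁ (~-sym s~w) ∂w ∂s (Exceptional-sym ex)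

    half : ∀ {m} → m ∈ₗ L s → m ≢ c → Half s w u v m
    -- Besides `s` and `v`, the vertex `x` must avoid `w` and `u`, the possible members of the
    -- opposite half, to stay uncoloured when both halves are precoloured.
    half {m} m∈s m≢c with fresh-nbr (w ∷ u ∷ v ∷ []) {v = s}
      (λ { (here s≡w) → ~⇒≢ s~w s≡w ; (there (here s≡u)) → ~⇒≢ (edge ∂s) s≡u
         ; (there (there (here s≡v))) → outer≢ ∂w ∂s (sym s≡v) })
    ... | x , s~x , x∉ = by (m ∈ᶜ? L v)
      where
      x≢s′ : x ≢ s
      x≢s′ = ≢-sym (~⇒≢ s~x)
      x≢w′ : x ≢ w
      x≢w′ eq = x∉ (here eq)
      x≢u′ : x ≢ u
      x≢u′ eq = x∉ (there (here eq))
      x≢v′ : x ≢ v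
      x≢v′ eq = x∉ (there (there (here eq)))
      v≢s : v ≢ s
      v≢s = outer≢ ∂w ∂s
      v≢w : v ≢ w
      v≢w = ≢-sym (~⇒≢ (edge ∂w))
      by : Dec (m ∈ₗ L v) → Half s w u v m
      by (yes m∈v) = record
        { T = s ∷ v ∷ [] ; short = s≤s (s≤s z≤n) ; root = here refl
        ; members = λ { (here eq) → inj₁ eq ; (there (here eq)) → inj₂ eq }
        ; lists = λ { (here refl) → m∈s ; (there (here refl)) → m∈v }
        ; x = x ; x≢s = x≢s′ ; x≢w = x≢w′ ; x≢u = x≢u′ ; x≢v = x≢v′
        ; slack = λ T⊆S σ≡m → repeat (~-sym s~x) (clique x≢s′ x≢w′ v≢s v≢w x≢v′) (≢-sym v≢s)
            (T⊆S (here refl)) (T⊆S (there (here refl))) (trans (σ≡m (here refl)) (sym (σ≡m (there (here refl))))) }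
      by (no m∉v) = record
        { T = s ∷ [] ; short = s≤s z≤n ; root = here refl
        ; members = λ { (here eq) → inj₁ eq }
        ; lists = λ { (here refl) → m∈s }
        ; x = x ; x≢s = x≢s′ ; x≢w = x≢w′ ; x≢u = x≢u′ ; x≢v = x≢v′
        ; slack = λ T⊆S σ≡m → foreign (~-sym s~x) (T⊆S (here refl))
            λ σs∈ → m∉v (constant x≢s′ x≢w′ v≢s v≢w (subst (_∈ₗ L x) (σ≡m (here refl)) σs∈) m≢c) }

    half-independent : ∀ {m y z} (h : Half s w u v m) → y ∈ₗ Half.T h → z ∈ₗ Half.T h → ¬ y ~ z
    half-independent h y∈ z∈ y~z with Half.members h y∈ | Half.members h z∈
    ... | inj₁ refl | inj₁ refl = ~-irrefl y~z
    ... | inj₁ refl | inj₂ refl = v≁s (~-sym y~z)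
    ... | inj₂ refl | inj₁ refl = v≁s y~z
    ... | inj₂ refl | inj₂ refl = ~-irrefl y~z

    half-∌w : ∀ {m t} (h : Half s w u v m) → t ∈ₗ Half.T h → t ≢ w
    half-∌w h t∈ refl with Half.members h t∈
    ... | inj₁ w≡s = ~⇒≢ s~w (sym w≡s)
    ... | inj₂ w≡v = ~⇒≢ (edge ∂w) w≡v

    half-∌x : ∀ {m} (h : Half s w u v m) → Half.x h ∉ₗ Half.T h
    half-∌x h x∈ = [ Half.x≢s h , Half.x≢v h ]′ (Half.members h x∈)

    half-bridge : ∀ {m} → m ≢ c → (h : Half s w u v m) → ∃ λ χ → IsL χ × χ w ≡ c × (∀ {t} → t ∈ₗ Half.T h → χ t ≡ m)
    half-bridge {m} m≢c h = colour-boundary ∂w (Half.T h) (λ _ → m) {fromWitness (s≤s (s≤s (Half.short h)))}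
      (λ w∈ → half-∌w h w∈ refl)
      (λ { (here x≡w) → Half.x≢w h x≡w ; (there x∈) → half-∌x h x∈ })
      (Half.slack h there (λ t∈ → update-neq (λ _ → m) c (half-∌w h t∈)))
      (λ y∈ z∈ y~z _ → half-independent h y∈ z∈ y~z) (Half.lists h) (λ _ _ → m≢c)

  module _ {c s w} (s~w : s ~ w) (∂s : Boundary c s) (∂w : Boundary c w) (ex : Exceptional c s w) where
    open Exceptional ex

    private
      u v : V
      u = outer ∂s
      v = outer ∂w

    -- Possibly four vertices are precoloured, too many for 4-connectivity; but what remains lies in
    -- a clique with the slack vertex `h.x`. The halves are disjoint since `v` sees `w` and `u` does
    -- not.
    half-half : ∀ {m m′} → m ≢ m′ → (h : Half s w u v m) (h′ : Half w s v u m′) →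
                ∃ λ χ → IsL χ × (∀ {t} → t ∈ₗ Half.T h → χ t ≡ m) × (∀ {t} → t ∈ₗ Half.T h′ → χ t ≡ m′)
    half-half {m} {m′} m≢m′ h h′ =
      let χ , Lχ , χ≗ = Extension.extension G L deg S σ record
            { proper = proper ; list = list
            ; reach = λ t∉ → _ , h.slack (∈-++⁺ˡ {ys = h′.T}) σ-T , to-x t∉ }
      in χ , Lχ , (λ t∈ → trans (χ≗ (∈-++⁺ˡ t∈)) (σ-T t∈)) , (λ t∈ → trans (χ≗ (∈-++⁺ʳ h.T t∈)) (σ-T′ t∈))
      where
      module h = Half h
      module h′ = Half h′
      S : List V
      S = h.T ++ h′.T
      σ : Coloring G
      σ t with t ∈ᵛ? h.T
      ... | yes _ = m
      ... | no _  = m′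
      disjoint : ∀ {t} → t ∈ₗ h′.T → t ∉ₗ h.T
      disjoint t∈′ t∈ with h.members t∈ | h′.members t∈′
      ... | inj₁ refl | inj₁ s≡w = ~⇒≢ s~w s≡w
      ... | inj₁ refl | inj₂ s≡u = ~⇒≢ (edge ∂s) s≡u
      ... | inj₂ refl | inj₁ v≡w = ~⇒≢ (edge ∂w) (sym v≡w)
      ... | inj₂ refl | inj₂ v≡u = outer≁ s~w ∂s ∂w ex (subst (_~ w) v≡u (~-sym (edge ∂w)))
      σ-T : ∀ {t} → t ∈ₗ h.T → σ t ≡ m
      σ-T {t} t∈ with t ∈ᵛ? h.T
      ... | yes _ = refl
      ... | no t∉ = contradiction t∈ t∉
      σ-T′ : ∀ {t} → t ∈ₗ h′.T → σ t ≡ m′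
      σ-T′ {t} t∈ with t ∈ᵛ? h.T
      ... | yes t∈T = contradiction t∈T (disjoint t∈)
      ... | no _    = refl
      proper : ∀ {y z} → y ∈ₗ S → z ∈ₗ S → y ~ z → σ y ≢ σ z
      proper y∈ z∈ y~z eq with ∈-++⁻ h.T y∈ | ∈-++⁻ h.T z∈
      ... | inj₁ y∈T | inj₁ z∈T = half-independent s~w ∂s ∂w ex h y∈T z∈T y~z
      ... | inj₂ y∈T | inj₂ z∈T = half-independent (~-sym s~w) ∂w ∂s (Exceptional-sym ex) h′ y∈T z∈T y~z
      ... | inj₁ y∈T | inj₂ z∈T = m≢m′ (trans (sym (σ-T y∈T)) (trans eq (σ-T′ z∈T)))
      ... | inj₂ y∈T | inj₁ z∈T = m≢m′ (trans (sym (σ-T z∈T)) (trans (sym eq) (σ-T′ y∈T)))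
      list : ∀ {y} → y ∈ₗ S → σ y ∈ₗ L y
      list y∈ with ∈-++⁻ h.T y∈
      ... | inj₁ y∈T = subst (_∈ₗ L _) (sym (σ-T y∈T)) (h.lists y∈T)
      ... | inj₂ y∈T = subst (_∈ₗ L _) (sym (σ-T′ y∈T)) (h′.lists y∈T)
      x∉S : h.x ∉ₗ S
      x∉S x∈ with ∈-++⁻ h.T x∈
      ... | inj₁ x∈T = half-∌x s~w ∂s ∂w ex h x∈T
      ... | inj₂ x∈T = [ h.x≢w , h.x≢u ]′ (h′.members x∈T)
      to-x : ∀ {t} → t ∉ₗ S → PathIn G (_∉ₗ S) t h.x
      to-x {t} t∉ with t ≟ h.x
      ... | yes refl = here t∉
      ... | no t≢x   = step t∉ (clique (λ { refl → t∉ (∈-++⁺ˡ h.root) }) (λ { refl → t∉ (∈-++⁺ʳ h.T h′.root) }) h.x≢s h.x≢w t≢x) (here x∉S)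

    -- The chain of precolourings is: `c` on `w`, `m` on the first half, `m′` on the second half,
    -- `c` on `s`. Each two consecutive ones have a common extension.
    exceptional-merge : ∀ {φ ψ} → IsL φ → IsL ψ → φ w ≡ c → ψ s ≡ c → φ ≈ ψ
    exceptional-merge Lφ Lψ φw ψs =
      let m  , m∈  , m≢c  , _    = another-colour c c s
          m′ , m′∈ , m′≢c , m′≢m = another-colour c m w
          h  = half s~w ∂s ∂w ex m∈ m≢c
          h′ = half (~-sym s~w) ∂w ∂s (Exceptional-sym ex) m′∈ m′≢c
          χ₁ , Lχ₁ , χ₁w , χ₁T = half-bridge s~w ∂s ∂w ex m≢c h
          χ₂ , Lχ₂ , χ₂T , χ₂T′ = half-half (≢-sym m′≢m) h h′
          χ₃ , Lχ₃ , χ₃s , χ₃T′ = half-bridge (~-sym s~w) ∂w ∂s (Exceptional-sym ex) m′≢c h′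
      in boundary-class ∂w Lφ Lχ₁ φw χ₁w
         ◅◅ agree≤3 (Half.T h) {fromWitness (≤-trans (s≤s (Half.short h)) (n≤1+n 3))} Lχ₁ Lχ₂
              (λ t∈ → trans (χ₂T t∈) (sym (χ₁T t∈))) (half-∌x s~w ∂s ∂w ex h) (Half.slack h (λ p → p) χ₁T)
         ◅◅ agree≤3 (Half.T h′) {fromWitness (≤-trans (s≤s (Half.short h′)) (n≤1+n 3))} Lχ₂ Lχ₃
              (λ t∈ → trans (χ₃T′ t∈) (sym (χ₂T′ t∈))) (half-∌x (~-sym s~w) ∂w ∂s (Exceptional-sym ex) h′) (Half.slack h′ (λ p → p) χ₂T′)
         ◅◅ boundary-class ∂s Lχ₃ Lψ χ₃s ψs

  -- Non-adjacent `w` and `s` can both receive `c`. Adjacent ones need a detour through a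
  -- precolouring with slack elsewhere, compatible with `c` on either: a foreign colour or twins
  -- outside {s, w}. If neither exists, the exceptional case is left.
  merge : ∀ {c w s φ ψ} → Boundary c w → Boundary c s → IsL φ → IsL ψ → φ w ≡ c → ψ s ≡ c → φ ≈ ψ
  merge {c} {w} {s} ∂w ∂s Lφ Lψ φw ψs with w ≟ s
  ... | yes refl = boundary-class ∂w Lφ Lψ φw ψs
  ... | no w≢s with s ~? w
  ...   | no s≁w =
    let χ , Lχ , χw , χ≗ = colour-boundary ∂w (s ∷ []) (λ _ → c) (λ { (here w≡s) → w≢s w≡s })
             (λ { (here v≡w) → ~⇒≢ (edge ∂w) (sym v≡w) ; (there (here v≡s)) → outer≢ ∂w ∂s v≡s })
             (foreign (~-sym (edge ∂w)) (here refl) (subst (_∉ₗ L _) (sym (update-eq (λ _ → c) w c)) (lacks ∂w)))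
             (λ { (here refl) (here refl) e _ → ~-irrefl e }) (λ { (here refl) → has ∂s })
             (λ { (here refl) s~w _ → s≁w s~w })
    in boundary-class ∂w Lφ Lχ φw χw ◅◅ boundary-class ∂s Lχ Lψ (χ≗ (here refl)) ψs
  ...   | yes s~w with any? (λ y → any? λ x → ¬? (y ≟ s) ×-dec ¬? (y ≟ w) ×-dec ¬? (x ≟ s) ×-dec ¬? (x ≟ w) ×-dec
                              (y ~? x) ×-dec Any.any? (λ m → ¬? (m ℕ.≟ c) ×-dec ¬? (m ∈ᶜ? L x)) (L y))
  ...     | yes (y , x , y≢s , y≢w , x≢s , x≢w , y~x , extra) =
    let m , m∈ , m≢c , m∉     = find extra
        χ₁ , Lχ₁ , χ₁w , χ₁y = bridge-foreign ∂w y~x m∈ m∉ y≢w x≢w m≢c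
        χ₂ , Lχ₂ , χ₂s , χ₂y = bridge-foreign ∂s y~x m∈ m∉ y≢s x≢s m≢c
    in boundary-class ∂w Lφ Lχ₁ φw χ₁w
       ◅◅ foreign-class Lχ₁ Lχ₂ y~x (subst (_∉ₗ L x) (sym χ₁y) m∉) (trans χ₂y (sym χ₁y))
       ◅◅ boundary-class ∂s Lχ₂ Lψ χ₂s ψs
  ...     | no no-extra = by (any? (λ y → any? λ z → ¬? (y ≟ s) ×-dec ¬? (y ≟ w) ×-dec ¬? (z ≟ s) ×-dec ¬? (z ≟ w) ×-dec
                                     ¬? (y ≟ z) ×-dec ¬? (y ~? z)))
    where
    ∉sw : ∀ {t} → t ≢ s → t ≢ w → t ∉ₗ s ∷ w ∷ []
    ∉sw t≢s t≢w (here t≡s)         = t≢s t≡s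
    ∉sw t≢s t≢w (there (here t≡w)) = t≢w t≡w
    ≢s : ∀ {t} → t ∉ₗ s ∷ w ∷ [] → t ≢ s
    ≢s t∉ t≡s = t∉ (here t≡s)
    ≢w : ∀ {t} → t ∉ₗ s ∷ w ∷ [] → t ≢ w
    ≢w t∉ t≡w = t∉ (there (here t≡w))
    constant : ∀ {y x m} → y ≢ s → y ≢ w → x ≢ s → x ≢ w → m ∈ₗ L y → m ≢ c → m ∈ₗ L x
    constant {m = m} y≢s y≢w x≢s x≢w m∈ m≢c = proj₂ (path-invariant {Q = λ t → t ∉ₗ s ∷ w ∷ [] × m ∈ₗ L t}
      (λ { {t} {t′} (t∉ , m∈t) t~t′ t′∉ → t′∉ , decidable-stable (m ∈ᶜ? L t′) λ m∉ →
             no-extra (t , t′ , ≢s t∉ , ≢w t∉ , ≢s t′∉ , ≢w t′∉ , t~t′ , lose m∈t (m≢c , m∉)) })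
      (∉sw y≢s y≢w , m∈) (connected (s ∷ w ∷ []) (∉sw y≢s y≢w) (∉sw x≢s x≢w)))
    by : Dec _ → _ ≈ _
    by (no none) = exceptional-merge s~w ∂s ∂w (record
      { constant = constant
      ; clique = λ {y} {x} y≢s y≢w x≢s x≢w y≢x → decidable-stable (y ~? x) λ y≁x → none (y , x , y≢s , y≢w , x≢s , x≢w , y≢x , y≁x) })
      Lφ Lψ φw ψs
    -- The first vertex `z′` beyond the closed neighbourhood of `y` completes an induced path `y`,
    -- `x`, `z′`, whose ends serve as twins at `x`.
    by (yes (y , z , y≢s , y≢w , z≢s , z≢w , y≢z , y≁z))
      with path-exit (λ t → (t ≟ y) ⊎-dec (y ~? t)) (connected (s ∷ w ∷ []) (∉sw y≢s y≢w) (∉sw z≢s z≢w))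
             (inj₁ refl) [ (λ z≡y → y≢z (sym z≡y)) , y≁z ]′
    ... | x , z′ , p , x~z′ , z′∉ , ¬q with path-end p
    ...   | x∉ , inj₁ refl = contradiction (inj₂ x~z′) ¬q
    ...   | x∉ , inj₂ y~x =
      let m , m∈ , m≢c , _ = another-colour c c y
          m∈′ = constant y≢s y≢w (≢s z′∉) (≢w z′∉) m∈ m≢c
          y≢z′ : y ≢ z′
          y≢z′ y≡z′ = ¬q (inj₁ (sym y≡z′))
          y≁z′ : ¬ y ~ z′
          y≁z′ y~z′ = ¬q (inj₂ y~z′)
          χ₁ , Lχ₁ , χ₁w , χ₁y , χ₁z = bridge-twins ∂w y~x (~-sym x~z′) y≢z′ y≁z′ m∈ m∈′ y≢w (≢w z′∉) (≢w x∉) m≢c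
          χ₂ , Lχ₂ , χ₂s , χ₂y , χ₂z = bridge-twins ∂s y~x (~-sym x~z′) y≢z′ y≁z′ m∈ m∈′ y≢s (≢s z′∉) (≢s x∉) m≢c
      in boundary-class ∂w Lφ Lχ₁ φw χ₁w
         ◅◅ repeat-class Lχ₁ Lχ₂ y~x (~-sym x~z′) y≢z′ (trans χ₁y (sym χ₁z)) (trans χ₂y (sym χ₁y)) (trans χ₂z (sym χ₁z))
         ◅◅ boundary-class ∂s Lχ₂ Lψ χ₂s ψs

  -- Moving an arbitrary colouring to the boundary.

  module _ {c w₀ v₀} (w₀~v₀ : w₀ ~ v₀) (c∈w₀ : c ∈ₗ L w₀) (c∉v₀ : c ∉ₗ L v₀) where

    private
      reaches : ∀ {φ w χ} → IsL φ → Boundary c w → φ w ≡ c → IsL χ → χ w₀ ≡ c → φ ≈ χ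
      reaches Lφ ∂w φw Lχ χw₀ = merge ∂w (boundary w₀~v₀ c∈w₀ c∉v₀) Lφ Lχ φw χw₀

    module _ {φ χ} (Lφ : IsL φ) (Lχ : IsL χ) (χw₀ : χ w₀ ≡ c) (S : List V) (short : length S ≤ 2)
             (v₀∉S : v₀ ∉ₗ S) (c-free : ∀ {y} → y ∈ₗ S → φ y ≢ c)
             (slack : ∀ {S′ σ} → (∀ {t} → t ∈ₗ S → t ∈ₗ S′) → (∀ {t} → t ∈ₗ S → σ t ≡ φ t) → S′ slackAt v₀ under σ) where

      private
        S<4 : True (length S <? 4)
        S<4 = fromWitness (≤-trans (s≤s short) (n≤1+n 3))

      recolour-boundary : φ ≈ χ
      recolour-boundary with any? (λ w → ¬? (w ∈ᵛ? S) ×-dec (c ∈ᶜ? L w) ×-dec any? λ v → (w ~? v) ×-dec ¬? (c ∈ᶜ? L v))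
      ... | yes (w , w∉S , c∈w , v , w~v , c∉v) =
        let ∂w = boundary w~v c∈w c∉v
            χ′ , Lχ′ , χ′w , χ′≗ = colour-boundary ∂w S φ {fromWitness (s≤s (s≤s short))} w∉S
              (λ { (here refl) → c∉v₀ c∈w ; (there v₀∈) → v₀∉S v₀∈ })
              (slack there (λ t∈ → update-neq φ c λ { refl → w∉S t∈ }))
              (λ _ _ → proj₁ Lφ _ _) (λ _ → proj₂ Lφ _) (λ y∈ _ → c-free y∈)
        in agree≤3 S {S<4} Lφ Lχ′ χ′≗ v₀∉S (slack (λ p → p) (λ _ → refl)) ◅◅ reaches Lχ′ ∂w χ′w Lχ χw₀
      ... | no none =
        let Lφ′ , φ≈φ′ = recolour L Lφ c∈w₀ (λ {z} _ → unused z)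
        in φ≈φ′ ◅◅ reaches Lφ′ (boundary w₀~v₀ c∈w₀ c∉v₀) (update-eq φ w₀ c) Lχ χw₀
        where
        unused : ∀ y → φ y ≢ c
        unused y φy≡c =
          let x , z , p , x~z , _ , c∉z = path-exit (λ t → c ∈ᶜ? L t) (connected S {S<4} (λ y∈ → c-free y∈ φy≡c) v₀∉S)
                                            (subst (_∈ₗ L y) φy≡c (proj₂ Lφ y)) c∉v₀
          in none (x , proj₁ (path-end p) , proj₂ (path-end p) , z , x~z , c∉z)

    -- The witness is sought at `v₀`, because its members are neighbours of a vertex whose list
    -- lacks `c`: coloured `c` they would be on the boundary already.
    to-boundary : ∀ {φ χ} → IsL φ → IsL χ → χ w₀ ≡ c → φ ≈ χ
    to-boundary {φ} Lφ Lχ χw₀ with any? (λ w → (φ w ℕ.≟ c) ×-dec any? λ v → (w ~? v) ×-dec ¬? (c ∈ᶜ? L v))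
    ... | yes (w , φw , v , w~v , c∉v) = reaches Lφ (boundary w~v (subst (_∈ₗ L w) φw (proj₂ Lφ w)) c∉v) φw Lχ χw₀
    ... | no none with witness tight Lφ v₀
    ...   | alien s s~v₀ φs∉ = recolour-boundary Lφ Lχ χw₀ (s ∷ []) (s≤s z≤n)
            (λ { (here refl) → ~-irrefl s~v₀ }) (λ { (here refl) φs → none (s , φs , v₀ , s~v₀ , c∉v₀) })
            (λ S⊆ σ≗ → foreign (~-sym s~v₀) (S⊆ (here refl)) (subst (_∉ₗ L v₀) (sym (σ≗ (here refl))) φs∉))
    ...   | twins s t s~v₀ t~v₀ s≢t φs≡φt = recolour-boundary Lφ Lχ χw₀ (s ∷ t ∷ []) (s≤s (s≤s z≤n))
            (λ { (here refl) → ~-irrefl s~v₀ ; (there (here refl)) → ~-irrefl t~v₀ })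
            (λ { (here refl) φs → none (s , φs , v₀ , s~v₀ , c∉v₀) ; (there (here refl)) φt → none (t , φt , v₀ , t~v₀ , c∉v₀) })
            (λ S⊆ σ≗ → repeat (~-sym s~v₀) (~-sym t~v₀) s≢t (S⊆ (here refl)) (S⊆ (there (here refl)))
              (trans (σ≗ (here refl)) (trans φs≡φt (sym (σ≗ (there (here refl)))))))

    nonidentical : ∀ {φ ψ} → IsL φ → IsL ψ → φ ≈ ψ
    nonidentical Lφ Lψ =
      let χ , Lχ , χw₀ , _ = colour-boundary (boundary w₀~v₀ c∈w₀ c∉v₀) [] (λ _ → c) (λ ())
               (λ { (here v₀≡w₀) → ~⇒≢ w₀~v₀ (sym v₀≡w₀) })
               (foreign (~-sym w₀~v₀) (here refl) (subst (_∉ₗ L v₀) (sym (update-eq (λ _ → c) w₀ c)) c∉v₀)) (λ ()) (λ ()) (λ ())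
      in to-boundary Lφ Lχ χw₀ ◅◅ LEquivalent-sym L (to-boundary Lψ Lχ χw₀)

-- All lists equal: classes of monochromatic pairs.

module Identical (G : Graph) (κ : KConnected G 4) (L : ListAssignment G) (deg : IsDegreeAssignment G L)
                 (tight : ∀ v → Lists.size G L v ≤ degree G v) (same : ∀ {u v m} → m ∈ₗ L u → m ∈ₗ L v) where
  open Paths G
  open Swaps G
  open Precolour G κ L deg

  record Dist2 (a b : V) : Set where
    constructor dist2
    field
      {mid}    : V
      left     : a ~ mid
      right    : b ~ mid
      distinct : a ≢ b
      apart    : ¬ a ~ b
  open Dist2

  Dist2-sym : ∀ {a b} → Dist2 a b → Dist2 b a
  Dist2-sym (dist2 l r a≢b a≁b) = dist2 r l (≢-sym a≢b) (≁-sym a≁b)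

  Equiv : V → V → V → V → Set
  Equiv a b c d = ∀ {φ ψ} → IsL φ → IsL ψ → φ a ≡ φ b → ψ c ≡ ψ d → φ ≈ ψ

  Equiv-sym : ∀ {a b c d} → Equiv a b c d → Equiv c d a b
  Equiv-sym e Lφ Lψ φ≡ ψ≡ = LEquivalent-sym L (e Lψ Lφ ψ≡ φ≡)

  flipˡ : ∀ {a b c d} → Equiv a b c d → Equiv b a c d
  flipˡ e Lφ Lψ φ≡ ψ≡ = e Lφ Lψ (sym φ≡) ψ≡

  flipʳ : ∀ {a b c d} → Equiv a b c d → Equiv a b d c
  flipʳ e Lφ Lψ φ≡ ψ≡ = e Lφ Lψ φ≡ (sym ψ≡)

  find-twins : ∀ {φ} → IsL φ → ∀ u → ∃₂ λ a b → φ a ≡ φ b × a ~ u × b ~ u × Dist2 a b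
  find-twins {φ} Lφ u with witness tight Lφ u
  ... | alien s _ φs∉ = contradiction (same (proj₂ Lφ s)) φs∉
  ... | twins a b a~u b~u a≢b eq = a , b , eq , a~u , b~u , dist2 a~u b~u a≢b (λ a~b → proj₁ Lφ a b a~b eq)

  permute : ∀ {φ} → IsL φ → ∀ {i j v} → i ∈ₗ L v → j ∈ₗ L v →
            IsL (λ w → swapCol G i j (φ w)) × φ ≈ (λ w → swapCol G i j (φ w))
  permute {φ} Lφ {i} {j} i∈ j∈ = Lφ′ , SwapOn⇒LEquivalent L some-vertex Lφ Lφ′ (record
    { inside = λ _ → refl ; outside = λ w∉ → contradiction ∈⊤ w∉ ; closed = λ _ _ _ _ → ∈⊤ })
    where
    list : ∀ w → swapCol G i j (φ w) ∈ₗ L w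
    list w = case Coloured? φ i j w of λ
      { (yes (inj₁ φw≡i)) → subst (_∈ₗ L w) (sym (swap-fst φw≡i)) (same j∈)
      ; (yes (inj₂ φw≡j)) → subst (_∈ₗ L w) (sym (swap-snd φw≡j)) (same i∈)
      ; (no ¬ij)          → subst (_∈ₗ L w) (sym (swap-other ¬ij)) (proj₂ Lφ w) }
    Lφ′ : IsL (λ w → swapCol G i j (φ w))
    Lφ′ = (λ y z y~z eq → proj₁ Lφ y z y~z (swap-injective i j eq)) , list

  -- The two colourings may use different colours on the pair; as all lists agree, a global exchange
  -- of these colours is valid and makes them the same.
  Equiv-refl : ∀ {a b} → Dist2 a b → Equiv a b a b
  Equiv-refl {a} {b} ab {φ} {ψ} Lφ Lψ φ≡ ψ≡ =
    let Lφ′ , φ≈φ′ = permute Lφ (proj₂ Lφ a) (proj₂ Lψ a)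
        φ′a = swap-fst {φ a} {ψ a} refl
    in φ≈φ′ ◅◅ repeat-class Lφ′ Lψ (left ab) (right ab) (distinct ab) (cong (swapCol G (φ a) (ψ a)) φ≡)
         (sym φ′a) (trans (sym ψ≡) (sym (swap-fst {φ a} {ψ a} (sym φ≡))))

  colour : ∃ λ i → ∀ v → i ∈ₗ L v
  colour = let i , i∈ , _ = another-colour 0 0 some-vertex in i , λ v → same i∈

  monochromatic : ∀ {a b} → Dist2 a b → ∃ λ χ → IsL χ × χ a ≡ χ b
  monochromatic {a} {b} ab =
    let i , i∈ = colour
        χ , Lχ , χ≗ = extend≤3 (a ∷ b ∷ []) (λ _ → i)
          (λ { (here m≡a) → ~⇒≢ (left ab) (sym m≡a) ; (there (here m≡b)) → ~⇒≢ (right ab) (sym m≡b) })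
          (repeat (~-sym (left ab)) (~-sym (right ab)) (distinct ab) (here refl) (there (here refl)) refl)
          (λ { (here refl) (here refl) e _ → ~-irrefl e ; (here refl) (there (here refl)) e _ → apart ab e
             ; (there (here refl)) (here refl) e _ → apart ab (~-sym e) ; (there (here refl)) (there (here refl)) e _ → ~-irrefl e })
          (λ _ → i∈ _)
    in χ , Lχ , trans (χ≗ (here refl)) (sym (χ≗ (there (here refl))))

  Equiv-trans : ∀ {a b c d e f} → Dist2 c d → Equiv a b c d → Equiv c d e f → Equiv a b e f
  Equiv-trans cd p q Lφ Lψ φ≡ ψ≡ = let χ , Lχ , χ≡ = monochromatic cd in p Lφ Lχ φ≡ χ≡ ◅◅ q Lχ Lψ χ≡ ψ≡

  -- The triple is independent and may get a single colour; three vertices do not separate G.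
  share : ∀ {a b c} → Dist2 a b → Dist2 a c → b ≢ c → ¬ b ~ c → Equiv a b a c
  share {a} {b} {c} ab ac b≢c b≁c Lφ Lψ φ≡ ψ≡ =
    let i , i∈ = colour
        χ , Lχ , χ≗ = extend≤3 (a ∷ b ∷ c ∷ []) (λ _ → i)
          (λ { (here m≡a) → ~⇒≢ (left ab) (sym m≡a) ; (there (here m≡b)) → ~⇒≢ (right ab) (sym m≡b)
             ; (there (there (here m≡c))) → apart ac (subst (a ~_) m≡c (left ab)) })
          (repeat (~-sym (left ab)) (~-sym (right ab)) (distinct ab) (here refl) (there (here refl)) refl)
          (λ y∈ z∈ y~z _ → independent y∈ z∈ y~z) (λ _ → i∈ _)
        χa = χ≗ (here refl)
        χb = χ≗ (there (here refl))
        χc = χ≗ (there (there (here refl)))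
    in Equiv-refl ab Lφ Lχ φ≡ (trans χa (sym χb)) ◅◅ Equiv-refl ac Lχ Lψ (trans χa (sym χc)) ψ≡
    where
    independent : ∀ {y z} → y ∈ₗ a ∷ b ∷ c ∷ [] → z ∈ₗ a ∷ b ∷ c ∷ [] → ¬ y ~ z
    independent (here refl) (here refl) e = ~-irrefl e
    independent (here refl) (there (here refl)) e = apart ab e
    independent (here refl) (there (there (here refl))) e = apart ac e
    independent (there (here refl)) (here refl) e = apart ab (~-sym e)
    independent (there (here refl)) (there (here refl)) e = ~-irrefl e
    independent (there (here refl)) (there (there (here refl))) e = b≁c e
    independent (there (there (here refl))) (here refl) e = apart ac (~-sym e)
    independent (there (there (here refl))) (there (here refl)) e = b≁c (~-sym e)
    independent (there (there (here refl))) (there (there (here refl))) e = ~-irrefl e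

  -- Linking disjoint pairs.

  record Disjoint (a b c d : V) : Set where
    constructor disjoint
    field
      a≢c : a ≢ c
      a≢d : a ≢ d
      b≢c : b ≢ c
      b≢d : b ≢ d

  record Off (a b c d t : V) : Set where
    constructor off
    field
      t≢a : t ≢ a
      t≢b : t ≢ b
      t≢c : t ≢ c
      t≢d : t ≢ d

  Mid : V → V → V → V → V → Set
  Mid a b c d u = (a ~ u × b ~ u) ⊎ (c ~ u × d ~ u)

  -- The pairs get different colours because edges between them are allowed. Four deleted vertices
  -- may separate G, so `reach` demands slack in every component.
  link-with : ∀ {i j} → i ≢ j → (∀ v → i ∈ₗ L v) → (∀ v → j ∈ₗ L v) →
              ∀ {a b c d} → Dist2 a b → Dist2 c d → Disjoint a b c d →
              (∀ {w} → Off a b c d w → ∃ λ u → Mid a b c d u × PathIn G (Off a b c d) w u) → Equiv a b c d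
  link-with {i} {j} i≢j i∈ j∈ {a} {b} {c} {d} ab cd (disjoint a≢c a≢d b≢c b≢d) reach Lφ Lψ φ≡ ψ≡ =
    let χ , Lχ , χ≗ = Extension.extension G L deg S σ record
          { proper = proper ; list = list ; reach = λ w∉ →
              let u , m , p = reach (∉⇒off w∉) in u , slack m , path-map off⇒∉ p }
    in Equiv-refl ab Lφ Lχ φ≡ (trans (trans (χ≗ a∈) σa) (sym (trans (χ≗ b∈) σb)))
       ◅◅ Equiv-refl cd Lχ Lψ (trans (trans (χ≗ c∈) σc) (sym (trans (χ≗ d∈) σd))) ψ≡
    where
    S : List V
    S = a ∷ b ∷ c ∷ d ∷ []
    a∈ : a ∈ₗ S
    a∈ = here refl
    b∈ : b ∈ₗ S
    b∈ = there (here refl)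
    c∈ : c ∈ₗ S
    c∈ = there (there (here refl))
    d∈ : d ∈ₗ S
    d∈ = there (there (there (here refl)))
    σ : Coloring G
    σ = update (update (λ _ → i) c j) d j
    σa : σ a ≡ i
    σa = trans (update-neq _ j a≢d) (update-neq _ j a≢c)
    σb : σ b ≡ i
    σb = trans (update-neq _ j b≢d) (update-neq _ j b≢c)
    σc : σ c ≡ j
    σc = trans (update-neq _ j (distinct cd)) (update-eq _ c j)
    σd : σ d ≡ j
    σd = update-eq _ d j
    i≢ : ∀ {p q} → p ≡ i → q ≡ j → p ≢ q
    i≢ σy σz eq = i≢j (trans (sym σy) (trans eq σz))
    side : ∀ {y} → y ∈ₗ S → (σ y ≡ i × y ∈ₗ a ∷ b ∷ []) ⊎ (σ y ≡ j × y ∈ₗ c ∷ d ∷ [])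
    side (here refl)                         = inj₁ (σa , here refl)
    side (there (here refl))                 = inj₁ (σb , there (here refl))
    side (there (there (here refl)))         = inj₂ (σc , here refl)
    side (there (there (there (here refl)))) = inj₂ (σd , there (here refl))
    within : ∀ {x x′ y z} → Dist2 x x′ → y ∈ₗ x ∷ x′ ∷ [] → z ∈ₗ x ∷ x′ ∷ [] → ¬ y ~ z
    within xx′ (here refl)         (here refl)         e = ~-irrefl e
    within xx′ (here refl)         (there (here refl)) e = apart xx′ e
    within xx′ (there (here refl)) (here refl)         e = apart xx′ (~-sym e)
    within xx′ (there (here refl)) (there (here refl)) e = ~-irrefl e
    proper : ∀ {y z} → y ∈ₗ S → z ∈ₗ S → y ~ z → σ y ≢ σ z
    proper y∈ z∈ y~z with side y∈ | side z∈
    ... | inj₁ (_  , p)  | inj₁ (_  , q)  = contradiction y~z (within ab p q)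
    ... | inj₁ (σy , _)  | inj₂ (σz , _)  = i≢ σy σz
    ... | inj₂ (σy , _)  | inj₁ (σz , _)  = ≢-sym (i≢ σz σy)
    ... | inj₂ (_  , p)  | inj₂ (_  , q)  = contradiction y~z (within cd p q)
    list : ∀ {y} → y ∈ₗ S → σ y ∈ₗ L y
    list {y} y∈ = [ (λ p → subst (_∈ₗ L y) (sym (proj₁ p)) (i∈ y)) , (λ p → subst (_∈ₗ L y) (sym (proj₁ p)) (j∈ y)) ]′ (side y∈)
    slack : ∀ {u} → Mid a b c d u → S slackAt u under σ
    slack (inj₁ (a~u , b~u)) = repeat (~-sym a~u) (~-sym b~u) (distinct ab) a∈ b∈ (trans σa (sym σb))
    slack (inj₂ (c~u , d~u)) = repeat (~-sym c~u) (~-sym d~u) (distinct cd) c∈ d∈ (trans σc (sym σd))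
    ∉⇒off : ∀ {w} → w ∉ₗ S → Off a b c d w
    ∉⇒off w∉ = off (λ { refl → w∉ a∈ }) (λ { refl → w∉ b∈ }) (λ { refl → w∉ c∈ }) (λ { refl → w∉ d∈ })
    off⇒∉ : ∀ {w} → Off a b c d w → w ∉ₗ S
    off⇒∉ (off p q r s) = λ { (here e) → p e ; (there (here e)) → q e ; (there (there (here e))) → r e ; (there (there (there (here e)))) → s e }

  link : ∀ {a b c d} → Dist2 a b → Dist2 c d → Disjoint a b c d →
         (∀ {w} → Off a b c d w → ∃ λ u → Mid a b c d u × PathIn G (Off a b c d) w u) → Equiv a b c d
  link = let i , i∈ = colour
             j , j∈ , j≢i , _ = another-colour i i some-vertex
         in link-with (≢-sym j≢i) i∈ (λ _ → same j∈)

  -- Bad components, the obstruction to linking.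

  record Bad (K : Subset n) (a b c d : V) : Set where
    field
      {x₀}   : V
      x₀∈K   : x₀ ∈ K
      outside : ∀ {x} → x ∈ K → Off a b c d x
      closed : ∀ {x y} → x ∈ K → x ~ y → Off a b c d y → y ∈ K
      no-mid : ∀ {x} → x ∈ K → ¬ Mid a b c d x
      rooted : ∀ {x} → x ∈ K → PathIn G (Off a b c d) x₀ x

  Off-swap : ∀ {a b c d t} → Off a b c d t → Off c d a b t
  Off-swap (off p q r s) = off r s p q

  Off-flipˡ : ∀ {a b c d t} → Off a b c d t → Off b a c d t
  Off-flipˡ (off p q r s) = off q p r s

  Off-flipʳ : ∀ {a b c d t} → Off a b c d t → Off a b d c t
  Off-flipʳ (off p q r s) = off p q s r

  Mid-swap : ∀ {a b c d u} → Mid a b c d u → Mid c d a b u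
  Mid-swap = [ inj₂ , inj₁ ]′

  Mid-flipˡ : ∀ {a b c d u} → Mid a b c d u → Mid b a c d u
  Mid-flipˡ (inj₁ (p , q)) = inj₁ (q , p)
  Mid-flipˡ (inj₂ m)       = inj₂ m

  Disjoint-swap : ∀ {a b c d} → Disjoint a b c d → Disjoint c d a b
  Disjoint-swap (disjoint p q r s) = disjoint (≢-sym p) (≢-sym r) (≢-sym q) (≢-sym s)

  Disjoint-flipˡ : ∀ {a b c d} → Disjoint a b c d → Disjoint b a c d
  Disjoint-flipˡ (disjoint p q r s) = disjoint r s p q

  Disjoint-flipʳ : ∀ {a b c d} → Disjoint a b c d → Disjoint a b d c
  Disjoint-flipʳ (disjoint p q r s) = disjoint q p s r

  Bad-swap : ∀ {K a b c d} → Bad K a b c d → Bad K c d a b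
  Bad-swap B = record
    { x₀∈K = x₀∈K ; outside = λ x∈ → Off-swap (outside x∈) ; closed = λ x∈ e o → closed x∈ e (Off-swap o)
    ; no-mid = λ x∈ m → no-mid x∈ (Mid-swap m) ; rooted = λ x∈ → path-map Off-swap (rooted x∈) }
    where open Bad B

  Bad-flipˡ : ∀ {K a b c d} → Bad K a b c d → Bad K b a c d
  Bad-flipˡ B = record
    { x₀∈K = x₀∈K ; outside = λ x∈ → Off-flipˡ (outside x∈) ; closed = λ x∈ e o → closed x∈ e (Off-flipˡ o)
    ; no-mid = λ x∈ m → no-mid x∈ (Mid-flipˡ m) ; rooted = λ x∈ → path-map Off-flipˡ (rooted x∈) }
    where open Bad B

  Bad-flipʳ : ∀ {K a b c d} → Bad K a b c d → Bad K a b d c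
  Bad-flipʳ B = Bad-swap (Bad-flipˡ (Bad-swap B))

  link-or-bad : ∀ {a b c d} → Dist2 a b → Dist2 c d → Disjoint a b c d → Equiv a b c d ⊎ ∃ λ K → Bad K a b c d
  link-or-bad {a} {b} {c} {d} ab cd dis = decide (any? λ w → off? w ×-dec ¬? (reaches? w))
    where
    off? : Decidable (Off a b c d)
    off? t = map′ (λ { (p , q , r , s) → off p q r s }) (λ { (off p q r s) → p , q , r , s })
               (¬? (t ≟ a) ×-dec ¬? (t ≟ b) ×-dec ¬? (t ≟ c) ×-dec ¬? (t ≟ d))
    mid? : Decidable (Mid a b c d)
    mid? u = ((a ~? u) ×-dec (b ~? u)) ⊎-dec ((c ~? u) ×-dec (d ~? u))
    Reaches : V → Set
    Reaches w = ∃ λ u → Mid a b c d u × PathIn G (Off a b c d) w u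
    reaches? : Decidable Reaches
    reaches? w = any? λ u → mid? u ×-dec path? off? w u
    decide : Dec (∃ λ w → Off a b c d w × ¬ Reaches w) → Equiv a b c d ⊎ ∃ λ K → Bad K a b c d
    decide (no none) = inj₁ (link ab cd dis λ {w} o → decidable-stable (reaches? w) λ ¬r → none (w , o , ¬r))
    decide (yes (w , o , ¬r)) = inj₂ (carrier , record
      { x₀∈K = root ; outside = λ x∈ → path-end (reached x∈) ; closed = closed
      ; no-mid = λ {x} x∈ m → ¬r (x , m , reached x∈) ; rooted = reached })
      where open Component (component off? o)

  module _ {K a b c d} (B : Bad K a b c d) (cd : c ≢ d) (dis : Disjoint a b c d) where
    open Bad B
    open Disjoint dis

    private
      abc : List V
      abc = a ∷ b ∷ c ∷ []

      d∉abc : d ∉ₗ abc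
      d∉abc (here d≡a)                 = a≢d (sym d≡a)
      d∉abc (there (here d≡b))         = b≢d (sym d≡b)
      d∉abc (there (there (here d≡c))) = cd (sym d≡c)

      off⇒∉abc : ∀ {t} → Off a b c d t → t ∉ₗ abc
      off⇒∉abc (off p q r _) = λ { (here e) → p e ; (there (here e)) → q e ; (there (there (here e))) → r e }

      ∉abc⇒off : ∀ {t} → t ∉ₗ abc → t ≢ d → Off a b c d t
      ∉abc⇒off t∉ t≢d = off (λ e → t∉ (here e)) (λ e → t∉ (there (here e))) (λ e → t∉ (there (there (here e)))) t≢d

    -- {a, b, c} does not separate `K` from `d`, and without these three the only way out of `K` is
    -- `d`.
    touches : ∃ λ x → x ∈ K × x ~ d
    touches with path-exit (_∈? K) (connected abc (off⇒∉abc (outside x₀∈K)) d∉abc) x₀∈K (λ d∈ → Off.t≢d (outside d∈) refl)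
    ... | x , y , p , x~y , y∉abc , y∉K with y ≟ d
    ...   | yes refl = x , proj₂ (path-end p) , x~y
    ...   | no y≢d   = contradiction (closed (proj₂ (path-end p)) x~y (∉abc⇒off y∉abc y≢d)) y∉K

    Avoids : V → Set
    Avoids t = t ∉ K × t ∉ₗ abc

    -- A path avoiding `a`, `b`, `c`, stopped at `d`, cannot enter `K`, which is closed among the
    -- vertices off the two pairs.
    escape : ∀ {w} → w ∉ K → Off a b c d w → PathIn G Avoids w d
    escape w∉K o = go (connected abc (off⇒∉abc o) d∉abc) w∉K o
      where
      d∉K : d ∉ K
      d∉K d∈ = Off.t≢d (outside d∈) refl
      go : ∀ {t} → PathIn G (_∉ₗ abc) t d → t ∉ K → Off a b c d t → PathIn G Avoids t d
      go (here _) t∉K o = contradiction refl (Off.t≢d o)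
      go (step {w = t′} t∉ t~t′ p) t∉K o with t′ ≟ d
      ... | yes refl = step (t∉K , t∉) t~t′ (here (d∉K , d∉abc))
      ... | no t′≢d  = step (t∉K , t∉) t~t′ (go p (λ t′∈ → t∉K (closed t′∈ (~-sym t~t′) o)) (∉abc⇒off (path-start p) t′≢d))

    escape-to : ∀ {u w} → u ∉ K → Off a b c d u → w ∉ K → w ∉ₗ abc → PathIn G Avoids w u
    escape-to {w = w} u∉K uo w∉K w∉ with w ≟ d
    ... | yes refl = path-reverse (escape u∉K uo)
    ... | no w≢d   = path-++ (escape w∉K (∉abc⇒off w∉ w≢d)) (path-reverse (escape u∉K uo))

  -- Each pair has a common neighbour that survives the deletion of both pairs. The property passes
  -- to the new pairs of the induction.
  record Strong (a b c d : V) : Set where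
    field
      {u v} : V
      a≢b   : a ≢ b
      a≁b   : ¬ a ~ b
      c≢d   : c ≢ d
      c≁d   : ¬ c ~ d
      dis   : Disjoint a b c d
      a~u   : a ~ u
      b~u   : b ~ u
      u≢c   : u ≢ c
      u≢d   : u ≢ d
      c~v   : c ~ v
      d~v   : d ~ v
      v≢a   : v ≢ a
      v≢b   : v ≢ b

    ab : Dist2 a b
    ab = dist2 a~u b~u a≢b a≁b

    cd : Dist2 c d
    cd = dist2 c~v d~v c≢d c≁d

    u-off : Off a b c d u
    u-off = off (≢-sym (~⇒≢ a~u)) (≢-sym (~⇒≢ b~u)) u≢c u≢d

  Strong-swap : ∀ {a b c d} → Strong a b c d → Strong c d a b
  Strong-swap S = record
    { a≢b = c≢d ; a≁b = c≁d ; c≢d = a≢b ; c≁d = a≁b ; dis = Disjoint-swap dis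
    ; a~u = c~v ; b~u = d~v ; u≢c = v≢a ; u≢d = v≢b ; c~v = a~u ; d~v = b~u ; v≢a = u≢c ; v≢b = u≢d }
    where open Strong S

  Strong-flipˡ : ∀ {a b c d} → Strong a b c d → Strong b a c d
  Strong-flipˡ S = record
    { a≢b = ≢-sym a≢b ; a≁b = ≁-sym a≁b ; c≢d = c≢d ; c≁d = c≁d ; dis = Disjoint-flipˡ dis
    ; a~u = b~u ; b~u = a~u ; u≢c = u≢c ; u≢d = u≢d ; c~v = c~v ; d~v = d~v ; v≢a = v≢b ; v≢b = v≢a }
    where open Strong S

  -- A new pair y, z around x ∈ K only leaves bad sets inside K: everything outside K still reaches u.
  shrink : ∀ {K K′ a b c d u x y z} → Bad K a b c d → c ≢ d → Disjoint a b c d → a ~ u → b ~ u → Off a b c d u →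
           x ∈ K → y ∈ K → z ∈ K ⊎ z ≡ c ⊎ z ≡ d → x ~ y → x ~ z → Bad K′ y z a b → K′ ⊂ K
  shrink {K} {K′} {a} {b} {c} {d} {u} {x} {y} {z} B c≢d dis a~u b~u uo x∈K y∈K z-case x~y x~z B′ =
    (λ {w} → K′⊆K {w}) , x , x∈K , λ x∈K′ → Bad.no-mid B′ x∈K′ (inj₁ (~-sym x~y , ~-sym x~z))
    where
    u∉K : u ∉ K
    u∉K u∈ = Bad.no-mid B u∈ (inj₁ (a~u , b~u))
    u∉K′ : u ∉ K′
    u∉K′ u∈ = Bad.no-mid B′ u∈ (inj₂ (a~u , b~u))
    stays : ∀ {w} {P : V → Set} → (∀ {t} → P t → Off y z a b t) → w ∈ K′ → ¬ PathIn G P w u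
    stays P⇒off w∈K′ p = u∉K′ (path-invariant (λ t∈ e pt → Bad.closed B′ t∈ e (P⇒off pt)) w∈K′ p)
    avoiding : ∀ {a b c d t} → t ∉ K × t ∉ₗ a ∷ b ∷ c ∷ [] → z ∈ K ⊎ z ≡ c → Off y z a b t
    avoiding (t∉K , t∉) zc = off (λ { refl → t∉K y∈K }) ([ (λ z∈ → λ { refl → t∉K z∈ }) , (λ { refl t≡c → t∉ (there (there (here t≡c))) }) ]′ zc)
                                 (λ e → t∉ (here e)) (λ e → t∉ (there (here e)))
    ∉abc : ∀ {w c} → Off y z a b w → w ≢ c → w ∉ₗ a ∷ b ∷ c ∷ []
    ∉abc o w≢c = λ { (here e) → Off.t≢c o e ; (there (here e)) → Off.t≢d o e ; (there (there (here e))) → w≢c e }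
    via-d : ∀ {w} → w ∈ K′ → w ∉ K → w ≢ c → z ∈ K ⊎ z ≡ c → ⊥
    via-d w∈K′ w∉K w≢c zc = stays (λ t → avoiding {d = d} t zc) w∈K′
      (escape-to B c≢d dis u∉K uo w∉K (∉abc (Bad.outside B′ w∈K′) w≢c))
    via-c : ∀ {w} → w ∈ K′ → w ∉ K → w ≢ d → z ∈ K ⊎ z ≡ d → ⊥
    via-c w∈K′ w∉K w≢d zd = stays (λ t → avoiding {d = c} t zd) w∈K′
      (escape-to (Bad-flipʳ B) (≢-sym c≢d) (Disjoint-flipʳ dis) u∉K (Off-flipʳ uo) w∉K (∉abc (Bad.outside B′ w∈K′) w≢d))
    K′⊆K : ∀ {w} → w ∈ K′ → w ∈ K
    K′⊆K {w} w∈K′ = decidable-stable (w ∈? K) λ w∉K → case z-case of λ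
      { (inj₁ z∈K) → case w ≟ c of λ
          { (no w≢c)   → via-d w∈K′ w∉K w≢c (inj₁ z∈K)
          ; (yes refl) → via-c w∈K′ w∉K c≢d (inj₁ z∈K) }
      ; (inj₂ (inj₁ refl)) → via-d w∈K′ w∉K (Off.t≢b (Bad.outside B′ w∈K′)) (inj₂ refl)
      ; (inj₂ (inj₂ refl)) → via-c w∈K′ w∉K (Off.t≢b (Bad.outside B′ w∈K′)) (inj₂ refl) }

  -- Common to the strong and the weak case. `near-cd` allows `b` but not `a` as an end: in the weak
  -- case `a` is the known mid of {c, d} and must stay outside the new pair.
  record Ctx (K : Subset n) (a b c d : V) : Set where
    field
      bad   : Bad K a b c d
      ab    : Dist2 a b
      cd    : Dist2 c d
      dis   : Disjoint a b c d
      {u}   : V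
      u∉K   : u ∉ K
      u-off : Off a b c d u
      near-ab : ∀ {x y z} → x ∈ K → y ∈ K → z ∈ K ⊎ z ≡ c ⊎ z ≡ d → x ~ y → x ~ z → y ≢ z → ¬ y ~ z → Equiv y z a b
      near-cd : ∀ {x y z} → x ∈ K → y ∈ K → z ∈ K ⊎ z ≡ b → x ~ y → x ~ z → y ≢ z → ¬ y ~ z → Equiv y z c d

  Ctx-flipʳ : ∀ {K a b c d} → Ctx K a b c d → Ctx K a b d c
  Ctx-flipʳ C = record
    { bad = Bad-flipʳ bad ; ab = ab ; cd = Dist2-sym cd ; dis = Disjoint-flipʳ dis ; u∉K = u∉K ; u-off = Off-flipʳ u-off
    ; near-ab = λ x∈ y∈ z-case → near-ab x∈ y∈ ([ inj₁ , [ (λ z≡d → inj₂ (inj₂ z≡d)) , (λ z≡c → inj₂ (inj₁ z≡c)) ]′ ]′ z-case)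
    ; near-cd = λ x∈ y∈ z-case x~y x~z y≢z y≁z → flipʳ (near-cd x∈ y∈ z-case x~y x~z y≢z y≁z) }
    where open Ctx C

  record Clique (K : Subset n) (a b c d : V) : Set where
    field
      adjacent : ∀ {x y} → x ∈ K → y ∈ K → x ≢ y → x ~ y
      ab-type  : ∀ {y} → y ∈ K → y ~ a ⊎ y ~ b
      cd-type  : ∀ {y} → y ∈ K → y ~ c ⊎ y ~ d

  Clique-flipˡ : ∀ {K a b c d} → Clique K a b c d → Clique K b a c d
  Clique-flipˡ cl = record
    { adjacent = adjacent ; ab-type = λ y∈ → [ inj₂ , inj₁ ]′ (ab-type y∈) ; cd-type = cd-type }
    where open Clique cl

  Clique-flipʳ : ∀ {K a b c d} → Clique K a b c d → Clique K a b d c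
  Clique-flipʳ cl = record
    { adjacent = adjacent ; ab-type = ab-type ; cd-type = λ y∈ → [ inj₂ , inj₁ ]′ (cd-type y∈) }
    where open Clique cl

  -- The structure of a bad component.

  module _ {K a b c d} (C : Ctx K a b c d) where
    open Ctx C
    open Bad bad

    private
      touches-b : ∃ λ x → x ∈ K × x ~ b
      touches-b = touches (Bad-swap bad) (distinct ab) (Disjoint-swap dis)

      touches-c : ∃ λ x → x ∈ K × x ~ c
      touches-c = touches (Bad-flipʳ bad) (≢-sym (distinct cd)) (Disjoint-flipʳ dis)

    touches-a : ∃ λ x → x ∈ K × x ~ a
    touches-a = touches (Bad-flipʳ (Bad-swap bad)) (≢-sym (distinct ab)) (Disjoint-flipʳ (Disjoint-swap dis))

    -- An induced path in `K` has ends equivalent to both pairs; without one the connected set `K`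
    -- is a clique. If `y` in `K` misses `c` and `d`, these three are independent, and `share` joins
    -- {y, c}, which is equivalent to {a, b}, to {c, d}; likewise for `a` and `b`.
    analyse : Equiv a b c d ⊎ Clique K a b c d
    analyse with any? (λ x → any? λ y → any? λ z → (x ∈? K) ×-dec (y ∈? K) ×-dec (z ∈? K) ×-dec
                       (x ~? y) ×-dec (x ~? z) ×-dec ¬? (y ≟ z) ×-dec ¬? (y ~? z))
    ... | yes (x , y , z , x∈ , y∈ , z∈ , x~y , x~z , y≢z , y≁z) = inj₁
      (Equiv-trans (dist2 (~-sym x~y) (~-sym x~z) y≢z y≁z)
        (Equiv-sym (near-ab x∈ y∈ (inj₁ z∈) x~y x~z y≢z y≁z)) (near-cd x∈ y∈ (inj₁ z∈) x~y x~z y≢z y≁z))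
    ... | no no-path = types (any? λ y → (y ∈? K) ×-dec ¬? (y ~? c) ×-dec ¬? (y ~? d))
                             (any? λ y → (y ∈? K) ×-dec ¬? (y ~? a) ×-dec ¬? (y ~? b))
      where
      close : ∀ {x y z} → x ∈ K → y ∈ K → z ∈ K → x ~ y → x ~ z → y ≢ z → y ~ z
      close {x} {y} {z} x∈ y∈ z∈ x~y x~z y≢z = decidable-stable (y ~? z) λ y≁z →
        no-path (x , y , z , x∈ , y∈ , z∈ , x~y , x~z , y≢z , y≁z)
      star : ∀ {x} → x ∈ K → x₀ ≢ x → x₀ ~ x
      star x∈ x₀≢x = [ (λ x₀≡x → contradiction x₀≡x x₀≢x) , (λ e → e) ]′ (proj₂ (path-invariant
        {Q = λ t → t ∈ K × (x₀ ≡ t ⊎ x₀ ~ t)}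
        (λ { (t∈ , inj₁ refl) t~t′ o → closed t∈ t~t′ o , inj₂ t~t′
           ; {y = t′} (t∈ , inj₂ x₀~t) t~t′ o → let t′∈ = closed t∈ t~t′ o in t′∈ , (case x₀ ≟ t′ of λ
               { (yes eq) → inj₁ eq ; (no neq) → inj₂ (close t∈ x₀∈K t′∈ (~-sym x₀~t) t~t′ neq) }) })
        (x₀∈K , inj₁ refl) (rooted x∈)))
      adjacent : ∀ {x y} → x ∈ K → y ∈ K → x ≢ y → x ~ y
      adjacent {x} {y} x∈ y∈ x≢y with x₀ ≟ x | x₀ ≟ y
      ... | yes refl | _        = star y∈ x≢y
      ... | no x₀≢x  | yes refl = ~-sym (star x∈ x₀≢x)
      ... | no x₀≢x  | no x₀≢y  = close x₀∈K x∈ y∈ (star x∈ x₀≢x) (star y∈ x₀≢y) x≢y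
      types : Dec (∃ λ y → y ∈ K × ¬ y ~ c × ¬ y ~ d) → Dec (∃ λ y → y ∈ K × ¬ y ~ a × ¬ y ~ b) →
              Equiv a b c d ⊎ Clique K a b c d
      types (yes (y , y∈ , y≁c , y≁d)) _ =
        let x , x∈ , x~c = touches-c
            x~y = adjacent x∈ y∈ λ { refl → y≁c x~c }
            y≢c = Off.t≢c (outside y∈)
            cy  = dist2 (~-sym x~c) (~-sym x~y) (≢-sym y≢c) (≁-sym y≁c)
        in inj₁ (Equiv-trans cy (flipʳ (Equiv-sym (near-ab x∈ y∈ (inj₂ (inj₁ refl)) x~y x~c y≢c y≁c)))
                   (share cy cd (Off.t≢d (outside y∈)) y≁d))
      types (no _) (yes (y , y∈ , y≁a , y≁b)) =
        let x , x∈ , x~b = touches-b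
            x~y = adjacent x∈ y∈ λ { refl → y≁b x~b }
            y≢b = Off.t≢b (outside y∈)
            by  = dist2 (~-sym x~b) (~-sym x~y) (≢-sym y≢b) (≁-sym y≁b)
        in inj₁ (Equiv-trans by (flipˡ (Equiv-sym (share by (Dist2-sym ab) (Off.t≢a (outside y∈)) y≁a)))
                   (flipˡ (near-cd x∈ y∈ (inj₂ refl) x~y x~b y≢b y≁b)))
      types (no c-or-d) (no a-or-b) = inj₂ record
        { adjacent = adjacent
        ; ab-type = λ {y} y∈ → case (y ~? a) ⊎-dec (y ~? b) of λ
            { (yes t) → t ; (no ¬t) → contradiction (y , y∈ , (λ e → ¬t (inj₁ e)) , (λ e → ¬t (inj₂ e))) a-or-b }
        ; cd-type = λ {y} y∈ → case (y ~? c) ⊎-dec (y ~? d) of λ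
            { (yes t) → t ; (no ¬t) → contradiction (y , y∈ , (λ e → ¬t (inj₁ e)) , (λ e → ¬t (inj₂ e))) c-or-d } }

    module _ (cl : Clique K a b c d) where
      open Clique cl

      c-pair : ∀ {y} → y ∈ K → y ~ d → Dist2 y c × Equiv y c a b
      c-pair {y} y∈ y~d =
        let x , x∈ , x~c = touches-c
            y≁c = λ y~c → no-mid y∈ (inj₂ (~-sym y~c , ~-sym y~d))
            y≢c = Off.t≢c (outside y∈)
            x~y = adjacent x∈ y∈ λ { refl → y≁c x~c }
        in dist2 (~-sym x~y) (~-sym x~c) y≢c y≁c , near-ab x∈ y∈ (inj₂ (inj₁ refl)) x~y x~c y≢c y≁c

      b-pair : ∀ {y} → y ∈ K → y ~ a → Dist2 y b × Equiv y b c d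
      b-pair {y} y∈ y~a =
        let x , x∈ , x~b = touches-b
            y≁b = λ y~b → no-mid y∈ (inj₁ (~-sym y~a , ~-sym y~b))
            y≢b = Off.t≢b (outside y∈)
            x~y = adjacent x∈ y∈ λ { refl → y≁b x~b }
        in dist2 (~-sym x~y) (~-sym x~b) y≢b y≁b , near-cd x∈ y∈ (inj₂ refl) x~y x~b y≢b y≁b

      -- Link {y, c} with {y′, b}: every vertex reaches z, which is a mid of one of them.
      through : ∀ {y y′ z} → y ∈ K → y ~ d → y′ ∈ K → y′ ~ a → z ∈ K → y ≢ y′ → z ≢ y → z ≢ y′ →
                z ~ c ⊎ z ~ b → z ~ a ⊎ z ~ d → Equiv a b c d
      through {y} {y′} {z} y∈ y~d y′∈ y′~a z∈ y≢y′ z≢y z≢y′ z-mid z-exit =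
        let yc , E₁ = c-pair y∈ y~d
            y′b , E₂ = b-pair y′∈ y′~a
        in Equiv-trans yc (Equiv-sym E₁) (Equiv-trans y′b
             (link yc y′b (disjoint y≢y′ (Off.t≢b (outside y∈)) (≢-sym (Off.t≢c (outside y′∈))) (≢-sym (Disjoint.b≢c dis)))
               λ o → z , mid-z , to-z o) E₂)
        where
        Free : V → Set
        Free = Off y c y′ b
        free : ∀ {t} → t ∉ K → t ≢ b → t ≢ c → Free t
        free t∉K t≢b t≢c = off (λ { refl → t∉K y∈ }) t≢c (λ { refl → t∉K y′∈ }) t≢b
        z-free : Free z
        z-free = off z≢y (Off.t≢c (outside z∈)) z≢y′ (Off.t≢b (outside z∈))
        mid-z : Mid y c y′ b z
        mid-z = [ (λ z~c → inj₁ (adjacent y∈ z∈ (≢-sym z≢y) , ~-sym z~c)) , (λ z~b → inj₂ (adjacent y′∈ z∈ (≢-sym z≢y′) , ~-sym z~b)) ]′ z-mid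
        to-d : ∀ {w} → w ∉ K → Off a b c d w → PathIn G Free w d
        to-d w∉K o = path-map (λ { (t∉K , t∉) → free t∉K (λ e → t∉ (there (here e))) (λ e → t∉ (there (there (here e)))) })
          (escape bad (distinct cd) dis w∉K o)
        to-a : ∀ {w} → w ∉ K → Off a b c d w → PathIn G Free w a
        to-a w∉K o = path-map (λ { (t∉K , t∉) → free t∉K (λ e → t∉ (there (there (here e)))) (λ e → t∉ (here e)) })
          (escape (Bad-flipʳ (Bad-swap bad)) (≢-sym (distinct ab)) (Disjoint-flipʳ (Disjoint-swap dis)) w∉K (Off-flipʳ (Off-swap o)))
        -- `u` lies outside `K` and off both pairs, so it can escape to `a` and to `d`; this joins
        -- `d` to `a` when the start is the one of them that `z` need not see.
        exit-by : z ~ a ⊎ z ~ d → ∀ {w} → w ∉ K → Free w → PathIn G Free w z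
        exit-by (inj₁ z~a) {w} w∉K o with w ≟ a | w ≟ d
        ... | yes refl | _        = step o (~-sym z~a) (here z-free)
        ... | no _     | yes refl = path-∷ʳ (path-++ (path-reverse (to-d u∉K u-off)) (to-a u∉K u-off)) (~-sym z~a) z-free
        ... | no w≢a   | no w≢d   = path-∷ʳ (to-a w∉K (off w≢a (Off.t≢d o) (Off.t≢b o) w≢d)) (~-sym z~a) z-free
        exit-by (inj₂ z~d) {w} w∉K o with w ≟ d | w ≟ a
        ... | yes refl | _        = step o (~-sym z~d) (here z-free)
        ... | no _     | yes refl = path-∷ʳ (path-++ (path-reverse (to-a u∉K u-off)) (to-d u∉K u-off)) (~-sym z~d) z-free
        ... | no w≢d   | no w≢a   = path-∷ʳ (to-d w∉K (off w≢a (Off.t≢d o) (Off.t≢b o) w≢d)) (~-sym z~d) z-free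
        to-z : ∀ {w} → Free w → PathIn G Free w z
        to-z {w} o with w ∈? K | w ≟ z
        ... | _      | yes refl = here o
        ... | yes w∈ | no w≢z   = step o (adjacent w∈ z∈ w≢z) (here z-free)
        ... | no w∉K | no _     = exit-by z-exit w∉K o

      record Triple : Set where
        field
          {p q e} : V
          p∈  : p ∈ K
          q∈  : q ∈ K
          e∈  : e ∈ K
          p~a : p ~ a
          q~b : q ~ b
          p≢q : p ≢ q
          e≢p : e ≢ p
          e≢q : e ≢ q

      -- `p` has a neighbour `e` besides `a`, `q` and whichever of `c`, `d` it sees. Not being a
      -- mid, `p` sees neither `b` nor the other of `c`, `d`; hence `e` lies in `K`.
      triple : Triple
      triple with touches-a | touches-b
      ... | p , p∈ , p~a | q , q∈ , q~b = with-type (cd-type p∈)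
        where
        p≢q : p ≢ q
        p≢q refl = no-mid p∈ (inj₁ (~-sym p~a , ~-sym q~b))
        make : ∀ {e} → p ~ e → e ≢ a → e ≢ q → e ≢ c → e ≢ d → Triple
        make p~e e≢a e≢q e≢c e≢d = record
          { p∈ = p∈ ; q∈ = q∈ ; p~a = p~a ; q~b = q~b ; p≢q = p≢q ; e≢q = e≢q ; e≢p = ≢-sym (~⇒≢ p~e)
          ; e∈ = closed p∈ p~e (off e≢a (λ { refl → no-mid p∈ (inj₁ (~-sym p~a , ~-sym p~e)) }) e≢c e≢d) }
        fresh : ∀ γ → p ~ γ → ∃ λ e → p ~ e × e ∉ₗ a ∷ q ∷ γ ∷ []
        fresh γ p~γ = fresh-nbr (a ∷ q ∷ γ ∷ []) {v = p}
          λ { (here p≡a) → Off.t≢a (outside p∈) p≡a ; (there (here p≡q)) → p≢q p≡q ; (there (there (here p≡γ))) → ~⇒≢ p~γ p≡γ }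
        with-type : p ~ c ⊎ p ~ d → Triple
        with-type (inj₁ p~c) = let e , p~e , e∉ = fresh c p~c in
          make p~e (λ q → e∉ (here q)) (λ q → e∉ (there (here q))) (λ q → e∉ (there (there (here q))))
            λ e≡d → no-mid p∈ (inj₂ (~-sym p~c , ~-sym (subst (p ~_) e≡d p~e)))
        with-type (inj₂ p~d) = let e , p~e , e∉ = fresh d p~d in
          make p~e (λ q → e∉ (here q)) (λ q → e∉ (there (here q)))
            (λ e≡c → no-mid p∈ (inj₂ (~-sym (subst (p ~_) e≡c p~e) , ~-sym p~d))) (λ q → e∉ (there (there (here q))))

  -- Induction on the bad component.

  Alike : V → V → V → V → Set
  Alike c d x y = (x ~ c × y ~ c) ⊎ (x ~ d × y ~ d)

  alike-or-not : ∀ {c d x y} → x ~ c ⊎ x ~ d → y ~ c ⊎ y ~ d → Alike c d x y ⊎ (x ~ c × y ~ d) ⊎ (x ~ d × y ~ c)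
  alike-or-not (inj₁ x~c) (inj₁ y~c) = inj₁ (inj₁ (x~c , y~c))
  alike-or-not (inj₁ x~c) (inj₂ y~d) = inj₂ (inj₁ (x~c , y~d))
  alike-or-not (inj₂ x~d) (inj₁ y~c) = inj₂ (inj₂ (x~d , y~c))
  alike-or-not (inj₂ x~d) (inj₂ y~d) = inj₁ (inj₂ (x~d , y~d))

  module _ {K a b c d} (C : Ctx K a b c d) (cl : Clique K a b c d) where

    -- `z` is a mid of {y′, b}, and it leaves `K` through the same one of `c`, `d` as `y`, which is
    -- not a member of the new pairs.
    alike-link : ∀ {y y′ z} → y ∈ K → y′ ∈ K → z ∈ K → Alike c d z y → z ~ b → y′ ~ a → y ≢ y′ → z ≢ y → z ≢ y′ → Equiv a b c d
    alike-link y∈ y′∈ z∈ (inj₂ (z~d , y~d)) z~b y′~a y≢y′ z≢y z≢y′ =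
      through C cl y∈ y~d y′∈ y′~a z∈ y≢y′ z≢y z≢y′ (inj₂ z~b) (inj₂ z~d)
    alike-link y∈ y′∈ z∈ (inj₁ (z~c , y~c)) z~b y′~a y≢y′ z≢y z≢y′ =
      flipʳ (through (Ctx-flipʳ C) (Clique-flipʳ cl) y∈ y~c y′∈ y′~a z∈ y≢y′ z≢y z≢y′ (inj₂ z~b) (inj₂ z~c))

  mutual
    private
      -- The pairs {y, z} and {a, b} have the mids `x` and `u`, so they are strong again, and any
      -- bad component of theirs is smaller than `K`.
      solve-near : ∀ {K a b c d} → Acc _⊂_ K → Strong a b c d → Bad K a b c d → ∀ {x y z} → x ∈ K → y ∈ K →
                   z ∈ K ⊎ z ≡ c ⊎ z ≡ d → x ~ y → x ~ z → y ≢ z → ¬ y ~ z → Equiv y z a b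
      solve-near {K} {a} {b} {c} {d} (acc rec) S B {x} {y} {z} x∈ y∈ z-case x~y x~z y≢z y≁z =
        case link-or-bad S′.ab S′.cd S′.dis of λ
          { (inj₁ E)         → E
          ; (inj₂ (K′ , B′)) → solve (rec (shrink B S.c≢d S.dis S.a~u S.b~u S.u-off x∈ y∈ z-case x~y x~z B′)) S′ B′ }
        where
        module S = Strong S
        open Bad B
        u∉K : S.u ∉ K
        u∉K u∈ = no-mid u∈ (inj₁ (S.a~u , S.b~u))
        z≢a : z ≢ a
        z≢a = [ (λ z∈ → Off.t≢a (outside z∈)) , [ (λ { refl → ≢-sym (Disjoint.a≢c S.dis) }) , (λ { refl → ≢-sym (Disjoint.a≢d S.dis) }) ]′ ]′ z-case
        z≢b : z ≢ b
        z≢b = [ (λ z∈ → Off.t≢b (outside z∈)) , [ (λ { refl → ≢-sym (Disjoint.b≢c S.dis) }) , (λ { refl → ≢-sym (Disjoint.b≢d S.dis) }) ]′ ]′ z-case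
        u≢z : S.u ≢ z
        u≢z = [ (λ z∈ → λ { refl → u∉K z∈ }) , [ (λ { refl → S.u≢c }) , (λ { refl → S.u≢d }) ]′ ]′ z-case
        S′ : Strong y z a b
        S′ = record
          { a≢b = y≢z ; a≁b = y≁z ; c≢d = S.a≢b ; c≁d = S.a≁b
          ; dis = disjoint (Off.t≢a (outside y∈)) (Off.t≢b (outside y∈)) z≢a z≢b
          ; a~u = ~-sym x~y ; b~u = ~-sym x~z ; u≢c = Off.t≢a (outside x∈) ; u≢d = Off.t≢b (outside x∈)
          ; c~v = S.a~u ; d~v = S.b~u ; v≢a = (λ { refl → u∉K y∈ }) ; v≢b = u≢z }
        module S′ = Strong S′

      solve-ctx : ∀ {K a b c d} → Acc _⊂_ K → Strong a b c d → Bad K a b c d → Ctx K a b c d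
      solve-ctx A S B = record
        { bad = B ; ab = ab ; cd = cd ; dis = dis ; u∉K = λ u∈ → Bad.no-mid B u∈ (inj₁ (a~u , b~u)) ; u-off = u-off
        ; near-ab = solve-near A S B
        ; near-cd = λ x∈ y∈ z-case → solve-near A (Strong-swap S) (Bad-swap B) x∈ y∈ ([ inj₁ , (λ e → inj₂ (inj₂ e)) ]′ z-case) }
        where open Strong S

      -- Two of `p`, `q`, `e` see the same one of `c`, `d`. If only `p` and `q` do, whether `e` sees
      -- `a` or `b` decides which roles the three take in `alike-link`.
      solve : ∀ {K a b c d} → Acc _⊂_ K → Strong a b c d → Bad K a b c d → Equiv a b c d
      solve {K} {a} {b} {c} {d} A S B with solve-ctx A S B | solve-ctx A (Strong-flipˡ S) (Bad-flipˡ B)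
      ... | C | C′ with analyse C
      ...   | inj₁ E  = E
      ...   | inj₂ cl = conclude (triple C cl)
        where
        conclude : Triple C cl → Equiv a b c d
        conclude t with alike-or-not (Clique.cd-type cl (Triple.p∈ t)) (Clique.cd-type cl (Triple.e∈ t))
                      | alike-or-not (Clique.cd-type cl (Triple.q∈ t)) (Clique.cd-type cl (Triple.e∈ t))
        ... | inj₁ pe | _ = flipˡ (alike-link C′ (Clique-flipˡ cl) e∈ q∈ p∈ pe p~a q~b e≢q (≢-sym e≢p) p≢q)
          where open Triple t
        ... | inj₂ _ | inj₁ qe = alike-link C cl e∈ p∈ q∈ qe q~b p~a e≢p (≢-sym e≢q) (≢-sym p≢q)
          where open Triple t
        ... | inj₂ x | inj₂ y = with-ab (Clique.ab-type cl e∈)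
          where
          open Triple t
          qp : Alike c d q p
          qp = alike x y
            where
            alike : (p ~ c × e ~ d) ⊎ (p ~ d × e ~ c) → (q ~ c × e ~ d) ⊎ (q ~ d × e ~ c) → Alike c d q p
            alike (inj₁ (p~c , _))   (inj₁ (q~c , _))   = inj₁ (q~c , p~c)
            alike (inj₁ (_ , e~d))   (inj₂ (_ , e~c))   = ⊥-elim (Bad.no-mid B e∈ (inj₂ (~-sym e~c , ~-sym e~d)))
            alike (inj₂ (_ , e~c))   (inj₁ (_ , e~d))   = ⊥-elim (Bad.no-mid B e∈ (inj₂ (~-sym e~c , ~-sym e~d)))
            alike (inj₂ (p~d , _))   (inj₂ (q~d , _))   = inj₂ (q~d , p~d)
          with-ab : e ~ a ⊎ e ~ b → Equiv a b c d
          with-ab (inj₁ e~a) = alike-link C cl p∈ e∈ q∈ qp q~b e~a (≢-sym e≢p) (≢-sym p≢q) (≢-sym e≢q)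
          with-ab (inj₂ e~b) = flipˡ (alike-link C′ (Clique-flipˡ cl) q∈ e∈ p∈ ([ (λ (g , h) → inj₁ (h , g)) , (λ (g , h) → inj₂ (h , g)) ]′ qp)
                                 p~a e~b (≢-sym e≢q) p≢q (≢-sym e≢p))

  strong : ∀ {a b c d} → Strong a b c d → Equiv a b c d
  strong S = [ (λ E → E) , (λ (K , B) → solve (⊂-wellFounded K) S B) ]′ (link-or-bad ab cd dis)
    where open Strong S

  -- A common neighbour inside the other pair.

  module _ {K a b c d} (C : Ctx K a b c d) (cl : Clique K a b c d) where
    open Ctx C
    open Bad bad
    open Clique cl

    -- The intermediate pair {a, z} has two common neighbours: `x` makes it strong against {y, c},
    -- and `c` makes it strong against {x, b}.
    bypass : ∀ {x y z} → x ∈ K → y ∈ K → z ∈ K → x ≢ y → x ≢ z → y ≢ z → a ~ c →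
             x ~ a → x ~ c → z ~ b → z ~ c → y ~ b → y ~ d → Equiv a b c d
    bypass {x} {y} {z} x∈ y∈ z∈ x≢y x≢z y≢z a~c x~a x~c z~b z~c y~b y~d =
      let yc , yc≈ab = c-pair C cl y∈ y~d
          xb , xb≈cd = b-pair C cl x∈ x~a
      in Equiv-trans yc (Equiv-sym yc≈ab) (Equiv-trans az (Equiv-sym (az≈yc yc)) (Equiv-trans xb (az≈xb xb) xb≈cd))
      where
      az : Dist2 a z
      az = dist2 (~-sym x~a) (adjacent z∈ x∈ (≢-sym x≢z)) (≢-sym (Off.t≢a (outside z∈)))
             λ a~z → no-mid z∈ (inj₁ (a~z , ~-sym z~b))
      az≈yc : Dist2 y c → Equiv a z y c
      az≈yc yc = strong record
        { a≢b = Dist2.distinct az ; a≁b = Dist2.apart az ; c≢d = Dist2.distinct yc ; c≁d = Dist2.apart yc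
        ; dis = disjoint (≢-sym (Off.t≢a (outside y∈))) (Disjoint.a≢c dis) (≢-sym y≢z) (Off.t≢c (outside z∈))
        ; a~u = ~-sym x~a ; b~u = adjacent z∈ x∈ (≢-sym x≢z) ; u≢c = x≢y ; u≢d = Off.t≢c (outside x∈)
        ; c~v = adjacent y∈ x∈ (≢-sym x≢y) ; d~v = ~-sym x~c ; v≢a = Off.t≢a (outside x∈) ; v≢b = x≢z }
      az≈xb : Dist2 x b → Equiv a z x b
      az≈xb xb = strong record
        { a≢b = Dist2.distinct az ; a≁b = Dist2.apart az ; c≢d = Dist2.distinct xb ; c≁d = Dist2.apart xb
        ; dis = disjoint (≢-sym (Off.t≢a (outside x∈))) (Dist2.distinct ab) (≢-sym x≢z) (Off.t≢b (outside z∈))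
        ; a~u = a~c ; b~u = z~c ; u≢c = ≢-sym (Off.t≢c (outside x∈)) ; u≢d = ≢-sym (Disjoint.b≢c dis)
        ; c~v = adjacent x∈ y∈ x≢y ; d~v = ~-sym y~b ; v≢a = Off.t≢a (outside y∈) ; v≢b = y≢z }

  -- Since `near-cd` is missing for `a`, the roles of `a` and `b` cannot be exchanged as in `solve`.
  -- The cases that this closes off use `p` as a mid of {q, c} or {q, d}, or use `bypass` with the
  -- edges from `a` to `c` and `d`.
  weak-clique : ∀ {K a b c d} (C : Ctx K a b c d) (cl : Clique K a b c d) → a ~ c → a ~ d → Triple C cl → Equiv a b c d
  weak-clique {K} {a} {b} {c} {d} C cl a~c a~d t = go (ab-type e∈) (cd-type p∈) (cd-type q∈) (cd-type e∈)
    where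
    open Clique cl
    open Triple t
    C′ : Ctx K a b d c
    C′ = Ctx-flipʳ C
    cl′ : Clique K a b d c
    cl′ = Clique-flipʳ cl
    go : e ~ a ⊎ e ~ b → p ~ c ⊎ p ~ d → q ~ c ⊎ q ~ d → e ~ c ⊎ e ~ d → Equiv a b c d
    go (inj₁ e~a) pt qt _ with alike-or-not qt pt
    ... | inj₁ qp = alike-link C cl p∈ e∈ q∈ qp q~b e~a (≢-sym e≢p) (≢-sym p≢q) (≢-sym e≢q)
    ... | inj₂ (inj₂ (q~d , p~c)) = through C cl q∈ q~d e∈ e~a p∈ (≢-sym e≢q) p≢q (≢-sym e≢p) (inj₁ p~c) (inj₁ p~a)
    ... | inj₂ (inj₁ (q~c , p~d)) = flipʳ (through C′ cl′ q∈ q~c e∈ e~a p∈ (≢-sym e≢q) p≢q (≢-sym e≢p) (inj₁ p~d) (inj₁ p~a))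
    go (inj₂ e~b) pt qt et with alike-or-not qt et | pt
    ... | inj₁ qe | _ = alike-link C cl e∈ p∈ q∈ qe q~b p~a e≢p (≢-sym e≢q) (≢-sym p≢q)
    ... | inj₂ (inj₁ (q~c , e~d)) | inj₁ p~c = bypass C cl p∈ e∈ q∈ (≢-sym e≢p) p≢q e≢q a~c p~a p~c q~b q~c e~b e~d
    ... | inj₂ (inj₁ (q~c , e~d)) | inj₂ p~d = flipʳ (bypass C′ cl′ p∈ q∈ e∈ p≢q (≢-sym e≢p) (≢-sym e≢q) a~d p~a p~d e~b e~d q~b q~c)
    ... | inj₂ (inj₂ (q~d , e~c)) | inj₁ p~c = bypass C cl p∈ q∈ e∈ p≢q (≢-sym e≢p) (≢-sym e≢q) a~c p~a p~c e~b e~c q~b q~d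
    ... | inj₂ (inj₂ (q~d , e~c)) | inj₂ p~d = flipʳ (bypass C′ cl′ p∈ e∈ q∈ (≢-sym e≢p) p≢q e≢q a~d p~a p~d q~b q~d e~b e~c)

  -- All pairs needed around `K` are strong against {a, b} and {c, d}, so `strong` replaces a second
  -- induction.
  weak-at : ∀ {a b c d u} → a ≢ b → ¬ a ~ b → a ~ u → b ~ u → u ≢ c → u ≢ d → c ≢ d → ¬ c ~ d → c ~ a → d ~ a →
            Disjoint a b c d → Equiv a b c d
  weak-at {a} {b} {c} {d} {u} a≢b a≁b a~u b~u u≢c u≢d c≢d c≁d c~a d~a dis = case link-or-bad ab cd dis of λ
    { (inj₁ E) → E ; (inj₂ (K , B)) → with-bad B }
    where
    ab : Dist2 a b
    ab = dist2 a~u b~u a≢b a≁b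
    cd : Dist2 c d
    cd = dist2 c~a d~a c≢d c≁d
    with-bad : ∀ {K} → Bad K a b c d → Equiv a b c d
    with-bad {K} B = case analyse C of λ
      { (inj₁ E) → E ; (inj₂ cl) → weak-clique C cl (~-sym c~a) (~-sym d~a) (triple C cl) }
      where
      open Bad B
      u∉K : u ∉ K
      u∉K u∈ = no-mid u∈ (inj₁ (a~u , b~u))
      C : Ctx K a b c d
      C = record
        { bad = B ; ab = ab ; cd = cd ; dis = dis ; u∉K = u∉K
        ; u-off = off (≢-sym (~⇒≢ a~u)) (≢-sym (~⇒≢ b~u)) u≢c u≢d
        ; near-ab = λ {x} {y} {z} x∈ y∈ z-case x~y x~z y≢z y≁z → strong record
            { a≢b = y≢z ; a≁b = y≁z ; c≢d = a≢b ; c≁d = a≁b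
            ; dis = disjoint (Off.t≢a (outside y∈)) (Off.t≢b (outside y∈))
                ([ (λ z∈ → Off.t≢a (outside z∈)) , [ (λ { refl → ≢-sym (Disjoint.a≢c dis) }) , (λ { refl → ≢-sym (Disjoint.a≢d dis) }) ]′ ]′ z-case)
                ([ (λ z∈ → Off.t≢b (outside z∈)) , [ (λ { refl → ≢-sym (Disjoint.b≢c dis) }) , (λ { refl → ≢-sym (Disjoint.b≢d dis) }) ]′ ]′ z-case)
            ; a~u = ~-sym x~y ; b~u = ~-sym x~z ; u≢c = Off.t≢a (outside x∈) ; u≢d = Off.t≢b (outside x∈)
            ; c~v = a~u ; d~v = b~u ; v≢a = λ { refl → u∉K y∈ }
            ; v≢b = [ (λ z∈ → λ { refl → u∉K z∈ }) , [ (λ { refl → u≢c }) , (λ { refl → u≢d }) ]′ ]′ z-case }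
        ; near-cd = λ {x} {y} {z} x∈ y∈ z-case x~y x~z y≢z y≁z → strong record
            { a≢b = y≢z ; a≁b = y≁z ; c≢d = c≢d ; c≁d = c≁d
            ; dis = disjoint (Off.t≢c (outside y∈)) (Off.t≢d (outside y∈))
                ([ (λ z∈ → Off.t≢c (outside z∈)) , (λ { refl → Disjoint.b≢c dis }) ]′ z-case)
                ([ (λ z∈ → Off.t≢d (outside z∈)) , (λ { refl → Disjoint.b≢d dis }) ]′ z-case)
            ; a~u = ~-sym x~y ; b~u = ~-sym x~z ; u≢c = Off.t≢c (outside x∈) ; u≢d = Off.t≢d (outside x∈)
            ; c~v = c~a ; d~v = d~a ; v≢a = ≢-sym (Off.t≢a (outside y∈))
            ; v≢b = [ (λ z∈ → ≢-sym (Off.t≢a (outside z∈))) , (λ { refl → a≢b }) ]′ z-case } }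

  weak : ∀ {a b c d u} → a ≢ b → ¬ a ~ b → a ~ u → b ~ u → u ≢ c → u ≢ d → Dist2 c d → Disjoint a b c d → Equiv a b c d
  weak {a} {b} {c} {d} a≢b a≁b a~u b~u u≢c u≢d (dist2 {v} c~v d~v c≢d c≁d) dis with v ≟ a | v ≟ b
  ... | yes refl | _        = weak-at a≢b a≁b a~u b~u u≢c u≢d c≢d c≁d c~v d~v dis
  ... | no _     | yes refl = flipˡ (weak-at (≢-sym a≢b) (≁-sym a≁b) b~u a~u u≢c u≢d c≢d c≁d c~v d~v (Disjoint-flipˡ dis))
  ... | no v≢a   | no v≢b   = strong record
        { a≢b = a≢b ; a≁b = a≁b ; c≢d = c≢d ; c≁d = c≁d ; dis = dis ; a~u = a~u ; b~u = b~u ; u≢c = u≢c ; u≢d = u≢d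
        ; c~v = c~v ; d~v = d~v ; v≢a = v≢a ; v≢b = v≢b }

  -- Twins with a common vertex.

  data Meet (a b c d : V) : Set where
    apart-pairs : Disjoint a b c d → Meet a b c d
    a≡c : a ≡ c → Meet a b c d
    a≡d : a ≡ d → Meet a b c d
    b≡c : b ≡ c → Meet a b c d
    b≡d : b ≡ d → Meet a b c d

  meet : ∀ a b c d → Meet a b c d
  meet a b c d with a ≟ c | a ≟ d | b ≟ c | b ≟ d
  ... | yes p | _     | _     | _     = a≡c p
  ... | no _  | yes p | _     | _     = a≡d p
  ... | no _  | no _  | yes p | _     = b≡c p
  ... | no _  | no _  | no _  | yes p = b≡d p
  ... | no p  | no q  | no r  | no s  = apart-pairs (disjoint p q r s)

  -- `a` is no neighbour of `b`, hence no twin at `b`. If `c` is none either, the twins are disjoint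
  -- from {a, c} and their mid `b` is outside it, as `weak` requires.
  twin-of : ∀ {φ ψ a b c} → IsL φ → IsL ψ → ψ a ≡ ψ c → Dist2 a c → ¬ a ~ b → b ≢ a → b ≢ c →
            φ ≈ ψ ⊎ ∃ λ z → φ c ≡ φ z × z ~ b × Dist2 c z
  twin-of {a = a} {b} {c} Lφ Lψ ψac ac a≁b b≢a b≢c with find-twins Lφ b
  ... | s , t , φst , s~b , t~b , st with meet s t a c
  ...   | a≡c refl = contradiction s~b a≁b
  ...   | a≡d refl = inj₂ (t , φst , t~b , st)
  ...   | b≡c refl = contradiction t~b a≁b
  ...   | b≡d refl = inj₂ (s , sym φst , s~b , Dist2-sym st)
  ...   | apart-pairs dis = inj₁ (weak (distinct st) (apart st) s~b t~b b≢a b≢c ac dis Lφ Lψ φst ψac)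

  twin-of-mid : ∀ {φ ψ a b u} → IsL φ → IsL ψ → φ a ≡ φ b → a ~ u → b ~ u → a ≢ b → ¬ a ~ b →
                φ ≈ ψ ⊎ ∃ λ z → ψ u ≡ ψ z × z ~ b × Dist2 u z
  twin-of-mid {a = a} {b} {u} Lφ Lψ φab a~u b~u a≢b a≁b with find-twins Lψ b
  ... | s , t , ψst , s~b , t~b , st with u ≟ s | u ≟ t
  ...   | yes refl | _        = inj₂ (t , ψst , t~b , st)
  ...   | no _     | yes refl = inj₂ (s , sym ψst , s~b , Dist2-sym st)
  ...   | no u≢s   | no u≢t   = inj₁ (weak a≢b a≁b a~u b~u u≢s u≢t st
          (disjoint (λ { refl → a≁b s~b }) (λ { refl → a≁b t~b }) (≢-sym (~⇒≢ s~b)) (≢-sym (~⇒≢ t~b))) Lφ Lψ φab ψst)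

  -- In the prism with triangles a z z′ and u b c, 4-connectivity gives a a further neighbour e: {e, u} or
  -- {e, z} links {a, b} with {a, c}, or else e is a mid of {u, z} outside {a, b}.
  prism : ∀ {φ ψ u a b c z z′} → IsL φ → IsL ψ → φ a ≡ φ b → ψ a ≡ ψ c → ψ u ≡ ψ z →
          a ~ u → b ~ u → c ~ u → a ~ z → b ~ z → a ~ z′ → c ~ z′ →
          Dist2 a b → Dist2 a c → Dist2 u z → z′ ≢ u → c ≢ z → φ ≈ ψ
  prism {u = u} {a} {b} {c} {z} {z′} Lφ Lψ φab ψac ψuz a~u b~u c~u a~z b~z a~z′ c~z′ ab ac uz z′≢u c≢z =
    let e , a~e , e∉ = fresh-nbr (u ∷ z ∷ z′ ∷ []) {v = a}
          (λ { (here eq) → ~⇒≢ a~u eq ; (there (here eq)) → ~⇒≢ a~z eq ; (there (there (here eq))) → ~⇒≢ a~z′ eq })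
    in finish a~e (λ eq → e∉ (here eq)) (λ eq → e∉ (there (here eq))) (λ eq → e∉ (there (there (here eq))))
    where
    finish : ∀ {e} → a ~ e → e ≢ u → e ≢ z → e ≢ z′ → _ ≈ _
    finish {e} a~e e≢u e≢z e≢z′ with e ~? u | e ~? z
    ... | no e≁u | _ =
      let eu = dist2 (~-sym a~e) (~-sym a~u) e≢u e≁u
      in Equiv-trans eu
           (weak (distinct ab) (apart ab) a~z b~z (≢-sym e≢z) (≢-sym (distinct uz)) eu
             (disjoint (~⇒≢ a~e) (~⇒≢ a~u) (λ { refl → apart ab a~e }) (~⇒≢ b~u)))
           (Equiv-sym (weak (distinct ac) (apart ac) a~z′ c~z′ (≢-sym e≢z′) z′≢u eu
             (disjoint (~⇒≢ a~e) (~⇒≢ a~u) (λ { refl → apart ac a~e }) (~⇒≢ c~u))))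
           Lφ Lψ φab ψac
    ... | yes _ | no e≁z =
      let ez = dist2 (~-sym a~e) (~-sym a~z) e≢z e≁z
      in Equiv-trans ez
           (weak (distinct ab) (apart ab) a~u b~u (≢-sym e≢u) (distinct uz) ez
             (disjoint (~⇒≢ a~e) (~⇒≢ a~z) (λ { refl → apart ab a~e }) (~⇒≢ b~z)))
           (Equiv-sym (weak (distinct ac) (apart ac) a~u c~u (≢-sym e≢u) (distinct uz) ez
             (disjoint (~⇒≢ a~e) (~⇒≢ a~z) (λ { refl → apart ac a~e }) c≢z)))
           Lφ Lψ φab ψac
    ... | yes e~u | yes e~z =
      Equiv-sym (weak (distinct uz) (apart uz) (~-sym e~u) (~-sym e~z) (≢-sym (~⇒≢ a~e)) (λ { refl → apart ab a~e }) ab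
        (disjoint (≢-sym (~⇒≢ a~u)) (≢-sym (~⇒≢ b~u)) (≢-sym (~⇒≢ a~z)) (≢-sym (~⇒≢ b~z))))
        Lφ Lψ φab ψuz

  -- Twins at `b` and `c` either link to a given pair or are forced: `z` is twin of `c` under `φ`
  -- and, by comparison of the two twin pairs at `b`, also of `u` under `ψ`; `z′` is twin of `b`
  -- under `ψ`. Unless `a` sees both `z` and `z′`, `share` applies.
  adjacent-twins : ∀ {φ ψ u a b c} → IsL φ → IsL ψ → φ a ≡ φ b → ψ a ≡ ψ c → a ~ u → b ~ u → c ~ u →
                   Dist2 a b → Dist2 a c → b ~ c → φ ≈ ψ
  adjacent-twins {u = u} {a} {b} {c} Lφ Lψ φab ψac a~u b~u c~u ab ac b~c
    with twin-of Lφ Lψ ψac ac (apart ab) (≢-sym (distinct ab)) (~⇒≢ b~c)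
       | twin-of-mid Lφ Lψ φab a~u b~u (distinct ab) (apart ab)
       | twin-of Lψ Lφ φab ab (apart ac) (≢-sym (distinct ac)) (≢-sym (~⇒≢ b~c))
  ... | inj₁ E | _ | _ = E
  ... | inj₂ _ | inj₁ E | _ = E
  ... | inj₂ _ | inj₂ _ | inj₁ E = LEquivalent-sym L E
  ... | inj₂ (z , φcz , z~b , cz) | inj₂ (t , ψut , t~b , ut) | inj₂ (z′ , ψbz′ , z′~c , bz′) with meet c z u t
  ...   | apart-pairs dis = weak (distinct cz) (apart cz) (~-sym b~c) z~b (~⇒≢ b~u) (≢-sym (~⇒≢ t~b)) ut dis Lφ Lψ φcz ψut
  ...   | a≡c refl = contradiction c~u ~-irrefl
  ...   | a≡d refl = contradiction (~-sym c~u) (apart ut)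
  ...   | b≡c refl = contradiction c~u (apart cz)
  ...   | b≡d refl with a ~? z | a ~? z′
  ...     | no a≁z | _ = share cz (Dist2-sym ac) (λ { refl → apart ab z~b }) (≁-sym a≁z) Lφ Lψ φcz (sym ψac)
  ...     | yes _  | no a≁z′ = share (Dist2-sym ab) bz′ (λ { refl → apart ac z′~c }) a≁z′ Lφ Lψ (sym φab) ψbz′
  ...     | yes a~z | yes a~z′ = prism Lφ Lψ φab ψac ψut a~u b~u c~u a~z (~-sym z~b) a~z′ (~-sym z′~c) ab ac ut
              (λ { refl → apart bz′ b~u }) (distinct cz)

  shared-twins : ∀ {φ ψ u a b c} → IsL φ → IsL ψ → φ a ≡ φ b → ψ a ≡ ψ c → a ~ u → b ~ u → c ~ u →
                 Dist2 a b → Dist2 a c → φ ≈ ψ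
  shared-twins {b = b} {c} Lφ Lψ φab ψac a~u b~u c~u ab ac with b ≟ c | b ~? c
  ... | yes refl | _      = Equiv-refl ab Lφ Lψ φab ψac
  ... | no b≢c   | no b≁c = share ab ac b≢c b≁c Lφ Lψ φab ψac
  ... | no _     | yes b~c = adjacent-twins Lφ Lψ φab ψac a~u b~u c~u ab ac b~c

  identical : ∀ {φ ψ} → IsL φ → IsL ψ → φ ≈ ψ
  -- Both twin pairs are taken at the same vertex, so that it is a mid outside both pairs, which is
  -- what `weak` needs when they are disjoint.
  identical Lφ Lψ with find-twins Lφ some-vertex | find-twins Lψ some-vertex
  ... | a , b , φab , a~u , b~u , ab | c , d , ψcd , c~u , d~u , cd with meet a b c d
  ...   | a≡c refl = shared-twins Lφ Lψ φab ψcd a~u b~u d~u ab cd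
  ...   | a≡d refl = shared-twins Lφ Lψ φab (sym ψcd) a~u b~u c~u ab (Dist2-sym cd)
  ...   | b≡c refl = shared-twins Lφ Lψ (sym φab) ψcd b~u a~u d~u (Dist2-sym ab) cd
  ...   | b≡d refl = shared-twins Lφ Lψ (sym φab) (sym ψcd) b~u a~u c~u (Dist2-sym ab) (Dist2-sym cd)
  ...   | apart-pairs dis = weak (distinct ab) (apart ab) a~u b~u (≢-sym (~⇒≢ c~u)) (≢-sym (~⇒≢ d~u)) cd dis Lφ Lψ φab ψcd

-- Division into surplus, unequal and equal lists.

theorem1p2 : (G : Graph) → KConnected G 4 → ¬ Complete G → DegreeSwappable G
theorem1p2 G κ ¬complete L deg φ ψ Lφ Lψ with any? (λ v → degree G v <? size v)
  where open Lists G L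
-- A surplus vertex is slack even for the empty precolouring, so there is only one class.
... | yes (v , surplus-v) = agree≤3 [] {u = v} Lφ Lψ (λ ()) (λ ()) (surplus surplus-v)
  where open Precolour G κ L deg
... | no no-surplus = by (any? λ w → any? λ v → (w ~? v) ×-dec Any.any? (λ c → ¬? (c ∈ᶜ? L v)) (L w))
  where
  open Paths G
  open Precolour G κ L deg
  tight : ∀ v → size v ≤ degree G v
  tight v = ≮⇒≥ λ d<s → no-surplus (v , d<s)
  by : Dec (∃ λ w → ∃ λ v → w ~ v × Any (_∉ₗ L v) (L w)) → φ ≈ ψ
  by (yes (w , v , w~v , differ)) = let c , c∈w , c∉v = find differ in
    NonIdentical.nonidentical G κ L deg tight ¬complete w~v c∈w c∉v Lφ Lψ
  by (no none) = Identical.identical G κ L deg tight same Lφ Lψ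
    where
    same : ∀ {u v m} → m ∈ₗ L u → m ∈ₗ L v
    same {m = m} m∈u = path-invariant
      (λ {x} {y} m∈x x~y _ → decidable-stable (m ∈ᶜ? L y) λ m∉y → none (x , y , x~y , lose m∈x m∉y))
      m∈u (connected [] (λ ()) (λ ()))
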